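{- There exists a constant $c$ such that for every integer $d \ge 2$, the $d$-dimensional hypercube $H_d$ satisfies $\mathrm{cub}(H_d) \le \frac{c\,d}{\log d}$.
   Context: The $d$-dimensional hypercube $H_d$ is the graph whose vertices correspond to the $2^d$ binary strings of length $d$, two vertices being adjacent if and only if the corresponding strings differ in exactly one bit position. A $k$-dimensional (axis-parallel) cube is a Cartesian product $R_1 \times R_2 \times \cdots \times R_k$ where each $R_i$ is a closed interval of the form $[a_i, a_i+1]$ on the real line. A finite simple graph $G$ is representable as the intersection graph of a family of sets $(S_x)_{x \in V(G)}$ if two distinct vertices $x,y$ are adjacent in $G$ if and only if $S_x \cap S_y \neq \emptyset$. The cubicity $\mathrm{cub}(G)$ is the minimum $k$ such that $G$ is representable as the intersection graph of axis-parallel cubes in $k$-dimensional space. -}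

module Defs where

open import Data.Bool.Base using (Bool)
open import Data.Empty using (⊥; ⊥-elim)
open import Data.Fin.Base using (Fin; zero)
open import Data.Fin.Properties using (2↔Bool; *↔×)
open import Data.Integer.Base as ℤ using (+_; -[1+_])
import Data.Integer.Properties as ℤ
open import Data.Nat.Base as ℕ using (ℕ; zero; suc)
import Data.Nat.Properties as ℕ
import Data.Nat.Tactic.RingSolver as ℕ-Solver
open import Data.Product.Base using (∃; _×_; _,_; proj₁; proj₂)
open import Data.Product using (∃!)
open import Data.Product.Function.NonDependent.Propositional using (_×-↔_)
open import Data.Rational.Base as ℚ using (ℚ; mkℚ; 0ℚ; 1ℚ; ½; toℚᵘ; fromℚᵘ)
import Data.Rational.Properties as ℚ
open import Data.Rational.Solver using (module +-*-Solver)
open import Data.Rational.Unnormalised.Base as ℚᵘ using (ℚᵘ; mkℚᵘ)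
import Data.Rational.Unnormalised.Properties as ℚᵘ
open import Data.Sum.Base using (_⊎_; inj₁; inj₂)
open import Data.Unit.Base using (⊤; tt)
open import Data.Vec.Base using (Vec; []; _∷_; lookup)
open import Function.Base using (_∘_; case_of_)
open import Function.Bundles using (_↔_; _⇔_; mk↔ₛ′)
open import Function.Construct.Composition using (_↔-∘_)
open import Function.Construct.Symmetry using (↔-sym)
open import Level using (0ℓ)
open import Relation.Binary.Core using (Rel)
open import Relation.Binary.Definitions using (Symmetric; Irreflexive; tri<; tri≈; tri>)
open import Relation.Binary.PropositionalEquality
open import Relation.Nullary.Decidable.Core using (yes; no)
open import Relation.Nullary.Negation.Core using (¬_)
open import Relation.Unary using (Pred; _≬_)

-- Two-sided, located Dedekind cuts.
record ℝ : Set₁ where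
  field
    Lower Upper     : Pred ℚ 0ℓ
    lower-inhabited : ∃ Lower
    upper-inhabited : ∃ Upper
    lower-closed    : ∀ {p q} → p ℚ.< q → Lower q → Lower p
    lower-open      : ∀ {q} → Lower q → ∃ λ r → q ℚ.< r × Lower r
    upper-closed    : ∀ {p q} → p ℚ.< q → Upper p → Upper q
    upper-open      : ∀ {q} → Upper q → ∃ λ r → r ℚ.< q × Upper r
    disjoint        : ∀ {q} → Lower q → ¬ Upper q
    located         : ∀ {p q} → p ℚ.< q → Lower p ⊎ Upper q

open ℝ public

infix 4 _≤_

_≤_ : Rel ℝ 0ℓ
x ≤ y = ∀ {q} → Lower x q → Lower y q

fromℚ : ℚ → ℝ
fromℚ p = record
  { Lower           = ℚ._< p
  ; Upper           = p ℚ.<_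
  ; lower-inhabited = p ℚ.- 1ℚ ,
      subst (p ℚ.- 1ℚ ℚ.<_) (ℚ.+-identityʳ p) (ℚ.+-monoʳ-< p (ℚ.negative⁻¹ (ℚ.- 1ℚ)))
  ; upper-inhabited = p ℚ.+ 1ℚ ,
      subst (ℚ._< p ℚ.+ 1ℚ) (ℚ.+-identityʳ p) (ℚ.+-monoʳ-< p (ℚ.positive⁻¹ 1ℚ))
  ; lower-closed    = ℚ.<-trans
  ; lower-open      = λ q<p → let r , q<r , r<p = ℚ.<-dense q<p in r , q<r , r<p
  ; upper-closed    = λ p<q r<p → ℚ.<-trans r<p p<q
  ; upper-open      = λ p<q → let r , p<r , r<q = ℚ.<-dense p<q in r , r<q , p<r
  ; disjoint        = ℚ.<-asym
  ; located         = loc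
  }
  where
  loc : ∀ {q r} → q ℚ.< r → q ℚ.< p ⊎ p ℚ.< r
  loc {q} q<r with q ℚ.<? p
  ... | yes q<p = inj₁ q<p
  ... | no  q≮p = inj₂ (ℚ.≤-<-trans (ℚ.≮⇒≥ q≮p) q<r)

0ℝ 1ℝ : ℝ
0ℝ = fromℚ 0ℚ
1ℝ = fromℚ 1ℚ

lower<upper : ∀ (x : ℝ) {p q} → Lower x p → Upper x q → p ℚ.< q
lower<upper x {p} {q} lp uq with ℚ.<-cmp p q
... | tri< p<q _ _    = p<q
... | tri≈ _ refl _   = ⊥-elim (disjoint x lp uq)
... | tri> _ _ q<p    = ⊥-elim (disjoint x (lower-closed x q<p lp) uq)

steps : ℕ → ℚ → ℚ → ℚ
steps zero    δ a = a
steps (suc n) δ a = steps n δ (a ℚ.+ δ)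

toℚ : ℕ → ℚ
toℚ zero    = 0ℚ
toℚ (suc n) = 1ℚ ℚ.+ toℚ n

steps≡ : ∀ n δ a → steps n δ a ≡ a ℚ.+ toℚ n ℚ.* δ
steps≡ zero δ a = solve 2 (λ δ a → a := a :+ con 0ℚ :* δ) refl δ a
  where open +-*-Solver
steps≡ (suc n) δ a = trans (steps≡ n δ (a ℚ.+ δ))
  (solve 3 (λ δ a t → (a :+ δ) :+ t :* δ := a :+ (con 1ℚ :+ t) :* δ) refl δ a (toℚ n))
  where open +-*-Solver

toℚᵘ-toℚ : ∀ n → toℚᵘ (toℚ n) ℚᵘ.≃ mkℚᵘ (+ n) 0
toℚᵘ-toℚ zero    = ℚᵘ.≃-refl
toℚᵘ-toℚ (suc n) = ℚᵘ.≃-trans (ℚ.toℚᵘ-homo-+ 1ℚ (toℚ n))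
  (ℚᵘ.≃-trans (ℚᵘ.+-congʳ (toℚᵘ 1ℚ) (toℚᵘ-toℚ n))
    (ℚᵘ.*≡* (cong (λ t → (+ 1 ℤ.+ t) ℤ.* + 1) (ℤ.*-identityʳ (+ n)))))

bounded : ∀ p → ∃ λ n → p ℚ.≤ toℚ n
bounded (mkℚ i m _) = ℤ.∣ i ∣ ,
  ℚ.toℚᵘ-cancel-≤ (ℚᵘ.≤-respʳ-≃ (ℚᵘ.≃-sym (toℚᵘ-toℚ ℤ.∣ i ∣)) (ℚᵘ.*≤* (lem i m)))
  where
  lem : ∀ i m → i ℤ.* (+ 1) ℤ.≤ (+ ℤ.∣ i ∣) ℤ.* (+ suc m)
  lem (+ n) m = subst₂ ℤ._≤_ (ℤ.pos-* n 1) (ℤ.pos-* n (suc m))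
    (ℤ.+≤+ (ℕ.*-monoʳ-≤ n (ℕ.s≤s ℕ.z≤n)))
  lem -[1+ n ] m = ℤ.-≤+

archimedean : ∀ a b δ → 0ℚ ℚ.< δ → ∃ λ n → b ℚ.≤ steps n δ a
archimedean a b δ 0<δ = n , subst₂ ℚ._≤_ eq (sym (steps≡ n δ a)) (ℚ.+-monoʳ-≤ a le)
  where
  instance
    pos : ℚ.Positive δ
    pos = ℚ.positive 0<δ
    nz : ℚ.NonZero δ
    nz = ℚ.pos⇒nonZero δ
    nn : ℚ.NonNegative δ
    nn = ℚ.pos⇒nonNeg δ
  t : ℚ
  t = (b ℚ.- a) ℚ.* (ℚ.1/ δ)
  n = proj₁ (bounded t)
  t*δ : t ℚ.* δ ≡ b ℚ.- a
  t*δ = trans (ℚ.*-assoc (b ℚ.- a) (ℚ.1/ δ) δ)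
    (trans (cong ((b ℚ.- a) ℚ.*_) (ℚ.*-inverseˡ δ)) (ℚ.*-identityʳ (b ℚ.- a)))
  le : t ℚ.* δ ℚ.≤ toℚ n ℚ.* δ
  le = ℚ.*-monoʳ-≤-nonNeg δ (proj₂ (bounded t))
  eq : a ℚ.+ t ℚ.* δ ≡ b
  eq = trans (cong (a ℚ.+_) t*δ) (solve 2 (λ a b → a :+ (b :- a) := b) refl a b)
    where open +-*-Solver

approximate : ∀ (x : ℝ) δ → 0ℚ ℚ.< δ → ∃ λ a → Lower x a × Upper x ((a ℚ.+ δ) ℚ.+ δ)
approximate x δ 0<δ = go n a la (weaken (upper-open x ub))
  where
  a = proj₁ (lower-inhabited x)
  la = proj₂ (lower-inhabited x)
  b = proj₁ (upper-inhabited x)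
  ub = proj₂ (upper-inhabited x)
  n = proj₁ (archimedean a b δ 0<δ)
  grow : ∀ a → a ℚ.< a ℚ.+ δ
  grow a = subst (ℚ._< a ℚ.+ δ) (ℚ.+-identityʳ a) (ℚ.+-monoʳ-< a 0<δ)
  weaken : (∃ λ r → r ℚ.< b × Upper x r) → Upper x (steps n δ a)
  weaken (r , r<b , ur) =
    upper-closed x (ℚ.<-≤-trans r<b (proj₂ (archimedean a b δ 0<δ))) ur
  go : ∀ n a → Lower x a → Upper x (steps n δ a) →
       ∃ λ a → Lower x a × Upper x ((a ℚ.+ δ) ℚ.+ δ)
  go zero    a la u = ⊥-elim (disjoint x la u)
  go (suc n) a la u with located x (grow (a ℚ.+ δ))
  ... | inj₁ l  = go n (a ℚ.+ δ) l u
  ... | inj₂ u′ = a , la , u′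

infixl 6 _+_

_+_ : ℝ → ℝ → ℝ
x + y = record
  { Lower = λ q → ∃ λ a → ∃ λ b → Lower x a × Lower y b × q ≡ a ℚ.+ b
  ; Upper = λ q → ∃ λ a → ∃ λ b → Upper x a × Upper y b × q ≡ a ℚ.+ b
  ; lower-inhabited =
      let a , la = lower-inhabited x ; b , lb = lower-inhabited y
      in a ℚ.+ b , a , b , la , lb , refl
  ; upper-inhabited =
      let a , ua = upper-inhabited x ; b , ub = upper-inhabited y
      in a ℚ.+ b , a , b , ua , ub , refl
  ; lower-closed = λ { {p} p<q (a , b , la , lb , refl) →
      a , p ℚ.- a , la , lower-closed y (subst (p ℚ.- a ℚ.<_) (cancel a b) (ℚ.+-monoˡ-< (ℚ.- a) p<q)) lb
      , restore a p }
  ; lower-open = λ { (a , b , la , lb , refl) → let a′ , a<a′ , la′ = lower-open x la in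
      a′ ℚ.+ b , ℚ.+-monoˡ-< b a<a′ , a′ , b , la′ , lb , refl }
  ; upper-closed = λ { {q = q} p<q (a , b , ua , ub , refl) →
      a , q ℚ.- a , ua , upper-closed y (subst (ℚ._< q ℚ.- a) (cancel a b) (ℚ.+-monoˡ-< (ℚ.- a) p<q)) ub
      , restore a q }
  ; upper-open = λ { (a , b , ua , ub , refl) → let a′ , a′<a , ua′ = upper-open x ua in
      a′ ℚ.+ b , ℚ.+-monoˡ-< b a′<a , a′ , b , ua′ , ub , refl }
  ; disjoint = λ { (a , b , la , lb , q≡) (a′ , b′ , ua , ub , q≡′) →
      ℚ.<-irrefl (trans (sym q≡) q≡′) (ℚ.+-mono-< (lower<upper x la ua) (lower<upper y lb ub)) }
  ; located = loc
  }
  where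
  open +-*-Solver
  cancel : ∀ a b → (a ℚ.+ b) ℚ.- a ≡ b
  cancel = solve 2 (λ a b → (a :+ b) :- a := b) refl
  restore : ∀ a p → p ≡ a ℚ.+ (p ℚ.- a)
  restore = solve 2 (λ a p → p := a :+ (p :- a)) refl
  loc : ∀ {p q} → p ℚ.< q →
        (∃ λ a → ∃ λ b → Lower x a × Lower y b × p ≡ a ℚ.+ b) ⊎
        (∃ λ a → ∃ λ b → Upper x a × Upper y b × q ≡ a ℚ.+ b)
  loc {p} {q} p<q = split (ℚ.<-dense p<q)
    where
    half : ∀ m p a → m ℚ.- ((a ℚ.+ ½ ℚ.* (m ℚ.- p)) ℚ.+ ½ ℚ.* (m ℚ.- p)) ≡ p ℚ.- a
    half = solve 3 (λ m p a →
      m :- ((a :+ con ½ :* (m :- p)) :+ con ½ :* (m :- p)) := p :- a) refl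
    finish : ∀ a c → Lower x a → Upper x c → p ℚ.- a ℚ.< q ℚ.- c → _
    finish a c la uc lt with located y lt
    ... | inj₁ l = inj₁ (a , p ℚ.- a , la , l , restore a p)
    ... | inj₂ u = inj₂ (c , q ℚ.- c , uc , u , restore c q)
    split : (∃ λ m → p ℚ.< m × m ℚ.< q) → _
    split (m , p<m , m<q) = let a , la , uc = approximate x δ 0<δ in
      finish a ((a ℚ.+ δ) ℚ.+ δ) la uc
        (subst (ℚ._< q ℚ.- ((a ℚ.+ δ) ℚ.+ δ)) (half m p a)
          (ℚ.+-monoˡ-< (ℚ.- ((a ℚ.+ δ) ℚ.+ δ)) m<q))
      where
      δ = ½ ℚ.* (m ℚ.- p)
      0<δ : 0ℚ ℚ.< δ
      0<δ = subst (ℚ._< δ) (ℚ.*-zeroʳ ½) (ℚ.*-monoʳ-<-pos ½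
        (subst (ℚ._< m ℚ.- p) (ℚ.+-inverseʳ p) (ℚ.+-monoˡ-< (ℚ.- p) p<m)))

infixr 7 _·_

_·_ : ℕ → ℝ → ℝ
zero  · x = 0ℝ
suc n · x = x + n · x

-- The cut of log₂ n is { q : 2^ q < n }, { q : 2^ q > n }.  Roots are cleared:
-- if q = i / m then 2^ q < n iff 2 ^ i < n ^ m.  As n ≥ 1, a negative i always
-- satisfies the former and never the latter.
2^_<_ 2^_>_ : ℚᵘ → ℕ → Set
2^ (mkℚᵘ (+ i)    m-1) < n = 2 ℕ.^ i ℕ.< n ℕ.^ suc m-1
2^ (mkℚᵘ -[1+ _ ] _)   < n = ⊤
2^ (mkℚᵘ (+ i)    m-1) > n = n ℕ.^ suc m-1 ℕ.< 2 ℕ.^ i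
2^ (mkℚᵘ -[1+ _ ] _)   > n = ⊥

-- d ^ m versus 2 ^ i determines d ^ m′ versus 2 ^ i′ when i / m ≤ i′ / m′
cross : ∀ d i m i′ m′ .{{_ : ℕ.NonZero m}} .{{_ : ℕ.NonZero m′}} →
        i ℕ.* m′ ℕ.≤ i′ ℕ.* m → d ℕ.^ m ℕ.≤ 2 ℕ.^ i → d ℕ.^ m′ ℕ.≤ 2 ℕ.^ i′
cross d i m i′ m′ le dm≤ with d ℕ.^ m′ ℕ.≤? 2 ℕ.^ i′
... | yes p = p
... | no ¬p = ⊥-elim (ℕ.<-irrefl refl (begin-strict
    (d ℕ.^ m) ℕ.^ m′   ≤⟨ ℕ.^-monoˡ-≤ m′ dm≤ ⟩
    (2 ℕ.^ i) ℕ.^ m′   ≡⟨ ℕ.^-*-assoc 2 i m′ ⟩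
    2 ℕ.^ (i ℕ.* m′)   ≤⟨ ℕ.^-monoʳ-≤ 2 le ⟩
    2 ℕ.^ (i′ ℕ.* m)   ≡⟨ ℕ.^-*-assoc 2 i′ m ⟨
    (2 ℕ.^ i′) ℕ.^ m   <⟨ ℕ.^-monoˡ-< m (ℕ.≰⇒> ¬p) ⟩
    (d ℕ.^ m′) ℕ.^ m   ≡⟨ ℕ.^-*-assoc d m′ m ⟩
    d ℕ.^ (m′ ℕ.* m)   ≡⟨ cong (d ℕ.^_) (ℕ.*-comm m′ m) ⟩
    d ℕ.^ (m ℕ.* m′)   ≡⟨ ℕ.^-*-assoc d m m′ ⟨
    (d ℕ.^ m) ℕ.^ m′   ∎))
  where open ℕ.≤-Reasoning

cross< : ∀ d i m i′ m′ .{{_ : ℕ.NonZero m}} .{{_ : ℕ.NonZero m′}} →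
         i ℕ.* m′ ℕ.≤ i′ ℕ.* m → d ℕ.^ m ℕ.< 2 ℕ.^ i → d ℕ.^ m′ ℕ.< 2 ℕ.^ i′
cross< d i m i′ m′ le dm< with d ℕ.^ m′ ℕ.<? 2 ℕ.^ i′
... | yes p = p
... | no ¬p = ⊥-elim (ℕ.<-irrefl refl (begin-strict
    (d ℕ.^ m) ℕ.^ m′   <⟨ ℕ.^-monoˡ-< m′ dm< ⟩
    (2 ℕ.^ i) ℕ.^ m′   ≡⟨ ℕ.^-*-assoc 2 i m′ ⟩
    2 ℕ.^ (i ℕ.* m′)   ≤⟨ ℕ.^-monoʳ-≤ 2 le ⟩
    2 ℕ.^ (i′ ℕ.* m)   ≡⟨ ℕ.^-*-assoc 2 i′ m ⟨
    (2 ℕ.^ i′) ℕ.^ m   ≤⟨ ℕ.^-monoˡ-≤ m (ℕ.≮⇒≥ ¬p) ⟩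
    (d ℕ.^ m′) ℕ.^ m   ≡⟨ ℕ.^-*-assoc d m′ m ⟩
    d ℕ.^ (m′ ℕ.* m)   ≡⟨ cong (d ℕ.^_) (ℕ.*-comm m′ m) ⟩
    d ℕ.^ (m ℕ.* m′)   ≡⟨ ℕ.^-*-assoc d m m′ ⟨
    (d ℕ.^ m) ℕ.^ m′   ∎))
  where open ℕ.≤-Reasoning

drop-+≤ : ∀ i m i′ m′ → mkℚᵘ (+ i) m ℚᵘ.≤ mkℚᵘ (+ i′) m′ → i ℕ.* suc m′ ℕ.≤ i′ ℕ.* suc m
drop-+≤ i m i′ m′ (ℚᵘ.*≤* le) =
  ℤ.drop‿+≤+ (subst₂ ℤ._≤_ (sym (ℤ.pos-* i (suc m′))) (sym (ℤ.pos-* i′ (suc m))) le)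

+≰- : ∀ i m i′ m′ → ¬ mkℚᵘ (+ i) m ℚᵘ.≤ mkℚᵘ -[1+ i′ ] m′
+≰- i m i′ m′ (ℚᵘ.*≤* le) = case subst (ℤ._≤ _) (sym (ℤ.pos-* i (suc m′))) le of λ ()

<-down : ∀ d p q → p ℚᵘ.≤ q → 2^ q < d → 2^ p < d
<-down d (mkℚᵘ (+ i) m) (mkℚᵘ (+ i′) m′) le lt =
  ℕ.≰⇒> λ ge → ℕ.<⇒≱ lt (cross d i (suc m) i′ (suc m′) (drop-+≤ i m i′ m′ le) ge)
<-down d (mkℚᵘ (+ i) m) (mkℚᵘ -[1+ i′ ] m′) le _ = ⊥-elim (+≰- i m i′ m′ le)
<-down d (mkℚᵘ -[1+ _ ] _) _ _ _ = tt

>-up : ∀ d p q → p ℚᵘ.≤ q → 2^ p > d → 2^ q > d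
>-up d (mkℚᵘ (+ i) m) (mkℚᵘ (+ i′) m′) le =
  cross< d i (suc m) i′ (suc m′) (drop-+≤ i m i′ m′ le)
>-up d (mkℚᵘ (+ i) m) (mkℚᵘ -[1+ i′ ] m′) le _ = ⊥-elim (+≰- i m i′ m′ le)

bernoulli : ∀ A K → A ℕ.^ K ℕ.* (A ℕ.+ K) ℕ.≤ suc A ℕ.^ K ℕ.* A
bernoulli A zero    = ℕ.≤-reflexive (cong (1 ℕ.*_) (ℕ.+-identityʳ A))
bernoulli A (suc K) = begin
    A ℕ.* P ℕ.* (A ℕ.+ suc K)                    ≤⟨ ℕ.m≤m+n _ (P ℕ.* K) ⟩
    A ℕ.* P ℕ.* (A ℕ.+ suc K) ℕ.+ P ℕ.* K        ≡⟨ expand A P K ⟩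
    suc A ℕ.* (P ℕ.* (A ℕ.+ K))                  ≤⟨ ℕ.*-monoʳ-≤ (suc A) (bernoulli A K) ⟩
    suc A ℕ.* (suc A ℕ.^ K ℕ.* A)                ≡⟨ ℕ.*-assoc (suc A) (suc A ℕ.^ K) A ⟨
    suc A ℕ.* suc A ℕ.^ K ℕ.* A                  ∎
  where
  open ℕ.≤-Reasoning
  P = A ℕ.^ K
  expand : ∀ A P K → A ℕ.* P ℕ.* (A ℕ.+ suc K) ℕ.+ P ℕ.* K ≡ suc A ℕ.* (P ℕ.* (A ℕ.+ K))
  expand = ℕ-Solver.solve-∀

doubled : ∀ {A B} → 1 ℕ.≤ A → A ℕ.< B → 2 ℕ.* A ℕ.^ suc A ℕ.< B ℕ.^ suc A
doubled {A} {B} 1≤A A<B = ℕ.<-≤-trans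
  (ℕ.*-cancelʳ-< A _ _ (begin-strict
    2 ℕ.* P ℕ.* A              <⟨ ℕ.m<m+n _ (ℕ.m^n>0 A (suc A)) ⟩
    2 ℕ.* P ℕ.* A ℕ.+ P        ≡⟨ expand A P ⟩
    P ℕ.* (A ℕ.+ suc A)        ≤⟨ bernoulli A (suc A) ⟩
    suc A ℕ.^ suc A ℕ.* A      ∎))
  (ℕ.^-monoˡ-≤ (suc A) A<B)
  where
  open ℕ.≤-Reasoning
  instance
    nz : ℕ.NonZero A
    nz = ℕ.>-nonZero 1≤A
  P = A ℕ.^ suc A
  expand : ∀ A P → 2 ℕ.* P ℕ.* A ℕ.+ P ≡ P ℕ.* (A ℕ.+ suc A)
  expand = ℕ-Solver.solve-∀

n<2^n : ∀ n → n ℕ.< 2 ℕ.^ n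
n<2^n zero    = ℕ.s≤s ℕ.z≤n
n<2^n (suc n) = begin-strict
    1 ℕ.+ n                      <⟨ ℕ.+-mono-≤-< (ℕ.m^n>0 2 n) (n<2^n n) ⟩
    2 ℕ.^ n ℕ.+ 2 ℕ.^ n          ≡⟨ cong (2 ℕ.^ n ℕ.+_) (ℕ.+-identityʳ _) ⟨
    2 ℕ.^ suc n                  ∎
  where open ℕ.≤-Reasoning

<-openᵘ : ∀ d p → 2^ p < d → ∃ λ q → p ℚᵘ.< q × 2^ q < d
<-openᵘ d (mkℚᵘ -[1+ i ] m) _ = mkℚᵘ -[1+ i ] (suc m) ,
  ℚᵘ.*<* (ℤ.*-monoˡ-<-neg -[1+ i ] (ℤ.+<+ (ℕ.n<1+n (suc m)))) , tt
<-openᵘ d (mkℚᵘ (+ i) m) lt = mkℚᵘ (+ suc (i ℕ.* K)) (A ℕ.+ m ℕ.* K) ,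
    ℚᵘ.*<* (subst₂ ℤ._<_ (ℤ.pos-* i (suc m ℕ.* K)) (ℤ.pos-* (suc (i ℕ.* K)) (suc m))
      (ℤ.+<+ numerators)) ,
    (begin-strict
      2 ℕ.* 2 ℕ.^ (i ℕ.* K)     ≡⟨ cong (2 ℕ.*_) (ℕ.^-*-assoc 2 i K) ⟨
      2 ℕ.* A ℕ.^ K             <⟨ doubled (ℕ.m^n>0 2 i) lt ⟩
      (d ℕ.^ suc m) ℕ.^ K       ≡⟨ ℕ.^-*-assoc d (suc m) K ⟩
      d ℕ.^ (suc m ℕ.* K)       ∎)
  where
  open ℕ.≤-Reasoning
  A = 2 ℕ.^ i
  K = suc A
  swap : ∀ i m K → i ℕ.* (suc m ℕ.* K) ≡ i ℕ.* K ℕ.* suc m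
  swap = ℕ-Solver.solve-∀
  numerators : i ℕ.* (suc m ℕ.* K) ℕ.< suc (i ℕ.* K) ℕ.* suc m
  numerators = begin-strict
    i ℕ.* (suc m ℕ.* K)         ≡⟨ swap i m K ⟩
    i ℕ.* K ℕ.* suc m           <⟨ ℕ.m<n+m _ ℕ.z<s ⟩
    suc (i ℕ.* K) ℕ.* suc m     ∎

>-openᵘ : ∀ d .{{_ : ℕ.NonZero d}} p → 2^ p > d → ∃ λ q → q ℚᵘ.< p × 2^ q > d
>-openᵘ d (mkℚᵘ (+ zero) m) gt = ⊥-elim (ℕ.<⇒≱ gt (ℕ.m^n>0 d (suc m)))
>-openᵘ d (mkℚᵘ (+ suc i) m) gt = mkℚᵘ (+ t) (B ℕ.+ m ℕ.* K) ,
    ℚᵘ.*<* (subst₂ ℤ._<_ (ℤ.pos-* t (suc m)) (ℤ.pos-* (suc i) (suc m ℕ.* K))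
      (ℤ.+<+ numerators)) ,
    ℕ.*-cancelˡ-< 2 _ _ (begin-strict
      2 ℕ.* d ℕ.^ (suc m ℕ.* K)     ≡⟨ cong (2 ℕ.*_) (ℕ.^-*-assoc d (suc m) K) ⟨
      2 ℕ.* B ℕ.^ K                 <⟨ doubled (ℕ.m^n>0 d (suc m)) gt ⟩
      (2 ℕ.^ suc i) ℕ.^ K           ≡⟨ ℕ.^-*-assoc 2 (suc i) K ⟩
      2 ℕ.^ suc t                   ∎)
  where
  open ℕ.≤-Reasoning
  B = d ℕ.^ suc m
  K = suc B
  t = B ℕ.+ i ℕ.* K
  swap : ∀ i m K → suc i ℕ.* K ℕ.* suc m ≡ suc i ℕ.* (suc m ℕ.* K)
  swap = ℕ-Solver.solve-∀
  numerators : t ℕ.* suc m ℕ.< suc i ℕ.* (suc m ℕ.* K)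
  numerators = begin-strict
    t ℕ.* suc m                     <⟨ ℕ.m<n+m _ ℕ.z<s ⟩
    suc t ℕ.* suc m                 ≡⟨ swap i m K ⟩
    suc i ℕ.* (suc m ℕ.* K)         ∎

disjointᵘ : ∀ d p → 2^ p < d → ¬ 2^ p > d
disjointᵘ d (mkℚᵘ (+ i) m) = ℕ.<-asym

locatedᵘ : ∀ d p q → p ℚᵘ.< q → 2^ p < d ⊎ 2^ q > d
locatedᵘ d (mkℚᵘ -[1+ _ ] _) _ _ = inj₁ tt
locatedᵘ d (mkℚᵘ (+ i) m) (mkℚᵘ -[1+ i′ ] m′) p<q = ⊥-elim (+≰- i m i′ m′ (ℚᵘ.<⇒≤ p<q))
locatedᵘ d (mkℚᵘ (+ i) m) (mkℚᵘ (+ i′) m′) (ℚᵘ.*<* p<q)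
  with 2 ℕ.^ i ℕ.<? d ℕ.^ suc m
... | yes lt = inj₁ lt
... | no  ge with d ℕ.^ suc m′ ℕ.<? 2 ℕ.^ i′
...   | yes gt = inj₂ gt
...   | no ¬gt = ⊥-elim (ℕ.<-irrefl refl (begin-strict
    (d ℕ.^ suc m) ℕ.^ suc m′      ≤⟨ ℕ.^-monoˡ-≤ (suc m′) (ℕ.≮⇒≥ ge) ⟩
    (2 ℕ.^ i) ℕ.^ suc m′          ≡⟨ ℕ.^-*-assoc 2 i (suc m′) ⟩
    2 ℕ.^ (i ℕ.* suc m′)          <⟨ ℕ.^-monoʳ-< 2 (ℕ.n<1+n 1) im′<i′m ⟩
    2 ℕ.^ (i′ ℕ.* suc m)          ≡⟨ ℕ.^-*-assoc 2 i′ (suc m) ⟨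
    (2 ℕ.^ i′) ℕ.^ suc m          ≤⟨ ℕ.^-monoˡ-≤ (suc m) (ℕ.≮⇒≥ ¬gt) ⟩
    (d ℕ.^ suc m′) ℕ.^ suc m      ≡⟨ ℕ.^-*-assoc d (suc m′) (suc m) ⟩
    d ℕ.^ (suc m′ ℕ.* suc m)      ≡⟨ cong (d ℕ.^_) (ℕ.*-comm (suc m′) (suc m)) ⟩
    d ℕ.^ (suc m ℕ.* suc m′)      ≡⟨ ℕ.^-*-assoc d (suc m) (suc m′) ⟨
    (d ℕ.^ suc m) ℕ.^ suc m′      ∎))
  where
  open ℕ.≤-Reasoning
  im′<i′m : i ℕ.* suc m′ ℕ.< i′ ℕ.* suc m
  im′<i′m = ℤ.drop‿+<+
    (subst₂ ℤ._<_ (sym (ℤ.pos-* i (suc m′))) (sym (ℤ.pos-* i′ (suc m))) p<q)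

-- The base only affects bounds involving a logarithm by a constant factor.
log₂ : (n : ℕ) .{{_ : ℕ.NonZero n}} → ℝ
log₂ n = record
  { Lower           = λ q → 2^ toℚᵘ q < n
  ; Upper           = λ q → 2^ toℚᵘ q > n
  ; lower-inhabited = ℚ.- 1ℚ , tt
  ; upper-inhabited = toℚ n , >-up n (mkℚᵘ (+ n) 0) (toℚᵘ (toℚ n))
      (ℚᵘ.≤-reflexive (ℚᵘ.≃-sym (toℚᵘ-toℚ n)))
      (subst (ℕ._< 2 ℕ.^ n) (sym (ℕ.*-identityʳ n)) (n<2^n n))
  ; lower-closed    = λ {p} {q} p<q → <-down n (toℚᵘ p) (toℚᵘ q) (ℚᵘ.<⇒≤ (ℚ.toℚᵘ-mono-< p<q))
  ; lower-open      = λ {q} l → case <-openᵘ n (toℚᵘ q) l of λ where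
      (r , q<r , l′) → fromℚᵘ r ,
        ℚ.toℚᵘ-cancel-< (ℚᵘ.<-respʳ-≃ (ℚᵘ.≃-sym (ℚ.toℚᵘ-fromℚᵘ r)) q<r) ,
        <-down n (toℚᵘ (fromℚᵘ r)) r (ℚᵘ.≤-reflexive (ℚ.toℚᵘ-fromℚᵘ r)) l′
  ; upper-closed    = λ {p} {q} p<q → >-up n (toℚᵘ p) (toℚᵘ q) (ℚᵘ.<⇒≤ (ℚ.toℚᵘ-mono-< p<q))
  ; upper-open      = λ {q} u → case >-openᵘ n (toℚᵘ q) u of λ where
      (r , r<q , u′) → fromℚᵘ r ,
        ℚ.toℚᵘ-cancel-< (ℚᵘ.<-respˡ-≃ (ℚᵘ.≃-sym (ℚ.toℚᵘ-fromℚᵘ r)) r<q) ,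
        >-up n r (toℚᵘ (fromℚᵘ r)) (ℚᵘ.≤-reflexive (ℚᵘ.≃-sym (ℚ.toℚᵘ-fromℚᵘ r))) u′
  ; disjoint        = λ {q} → disjointᵘ n (toℚᵘ q)
  ; located         = λ {p} {q} p<q → locatedᵘ n (toℚᵘ p) (toℚᵘ q) (ℚ.toℚᵘ-mono-< p<q)
  }

record Graph : Set₁ where
  infix 4 _~_
  field
    V          : Set
    _~_        : Rel V 0ℓ
    symmetric  : Symmetric _~_
    irrefl     : Irreflexive _≡_ _~_
    order      : ℕ
    enumerated : V ↔ Fin order

open Graph using (V)

IsIntersectionGraph : ∀ {a ℓ} {A : Set a} (G : Graph) → (V G → Pred A ℓ) → Set _
IsIntersectionGraph G S = ∀ {x y} → x ≢ y → x ~ y ⇔ S x ≬ S y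
  where open Graph G using (_~_)

ℝ^ : ℕ → Set₁
ℝ^ k = Fin k → ℝ

-- The points of the product of the intervals [ a i , a i + 1 ].
cube : ∀ {k} → ℝ^ k → Pred (ℝ^ k) 0ℓ
cube a p = ∀ i → a i ≤ p i × p i ≤ a i + 1ℝ

CubeRepresentable : Graph → ℕ → Set₁
CubeRepresentable G k = ∃ λ (corner : V G → ℝ^ k) → IsIntersectionGraph G (cube ∘ corner)

IsCubicity : Graph → ℕ → Set₁
IsCubicity G k = CubeRepresentable G k × (∀ j → CubeRepresentable G j → k ℕ.≤ j)

strings : ∀ d → Vec Bool d ↔ Fin (2 ℕ.^ d)
strings zero    = mk↔ₛ′ (λ _ → zero) (λ _ → []) (λ { zero → refl }) (λ { [] → refl })
strings (suc d) = ↔-sym *↔× ↔-∘ ((↔-sym 2↔Bool ×-↔ strings d) ↔-∘ uncons↔)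
  where
  uncons↔ : Vec Bool (suc d) ↔ (Bool × Vec Bool d)
  uncons↔ = mk↔ₛ′ (λ { (b ∷ v) → b , v }) (λ { (b , v) → b ∷ v }) (λ _ → refl) (λ { (_ ∷ _) → refl })

hypercube : ℕ → Graph
hypercube d = record
  { V          = Vec Bool d
  ; _~_        = λ u v → ∃! _≡_ λ i → lookup u i ≢ lookup v i
  ; symmetric  = λ { (i , u≢v , unique) → i , u≢v ∘ sym , λ v≢u → unique (v≢u ∘ sym) }
  ; irrefl     = λ { refl (i , u≢u , _) → u≢u refl }
  ; order      = 2 ℕ.^ d
  ; enumerated = strings d
  }

module Submission where

-- The hypercube is representable by cubes in dimension k as soon as k integer
-- tests on its vertices, each changing by at most 1 along every edge, have the
-- property that any two distinct non-adjacent vertices differ by at least 2 on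
-- some test.  If the tests f_i merely determine the vertex u, and g_i denotes
-- f_i rounded up or down to the parity of u, then on pairs (u , u′) the tests
-- g_i(u) ± g_i(u′) differ by at least 2 unless the two pairs share one of their
-- halves, and any separating tests h for one half, used as h(u) + h(u′), take
-- care of the other half.  Halving repeatedly yields a geometric series, so the
-- cost is that of a determining family, which is O(d / log d) by the recursive
-- coin weighing designs of Cantor and Mills.

open import Data.Bool.Base using (Bool; true; false; _xor_)
import Data.Bool.Properties as Bool
open import Data.Empty using (⊥; ⊥-elim)
open import Data.Fin.Base using (Fin; zero; suc)
import Data.Fin.Properties as Fin
open import Data.Integer.Base as ℤ using (ℤ; +_; -[1+_]; ∣_∣; 0ℤ; 1ℤ)
open import Data.Integer.DivMod using (_/ℕ_; _%ℕ_; n%ℕd<d; a≡a%ℕn+[a/ℕn]*n)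
import Data.Integer.Properties as ℤ
open import Algebra.Properties.AbelianGroup ℤ.+-0-abelianGroup using (∙-cancelˡ; ∙-cancelʳ)
import Data.Integer.Tactic.RingSolver as ℤ-Solver
open import Data.Nat.Base as ℕ using (ℕ; zero; suc; z≤n; s≤s; NonZero)
import Data.Nat.Coprimality as Coprimality
import Data.Nat.Properties as ℕ
import Data.Nat.Tactic.RingSolver as ℕ-Solver
open import Data.Product.Base using (∃; ∃₂; _×_; _,_; proj₁; proj₂)
open import Data.Rational.Base as ℚ using (ℚ; mkℚ; toℚᵘ; 1ℚ)
import Data.Rational.Properties as ℚ
open import Data.Rational.Solver using (module +-*-Solver)
open import Data.Rational.Unnormalised.Base as ℚᵘ using (mkℚᵘ)
import Data.Rational.Unnormalised.Properties as ℚᵘ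
open import Data.Sum.Base as Sum using (_⊎_; inj₁; inj₂; [_,_])
open import Data.Sum.Function.Propositional using (_⊎-↔_)
open import Data.Vec.Base using (Vec; []; _∷_; _++_; lookup; take; drop)
import Data.Vec.Properties as Vec
open import Function.Base using (_∘_; id)
open import Function.Bundles using (_↔_; Inverse; mk⇔)
open import Function.Construct.Composition using (_↔-∘_)
open import Function.Construct.Identity using (↔-id)
open import Relation.Binary.PropositionalEquality hiding ([_])
open import Relation.Nullary.Decidable.Core using (Dec; yes; no; decidable-stable)
open import Relation.Nullary.Negation.Core using (contradiction)
open import Relation.Unary using (_≬_)

module Tests where

  open import Data.Integer.Base using (-_; _+_; _-_; _*_)

  -- Integers at distance at most 1, parity and halving.

  bit : Bool → ℤ
  bit false = 0ℤ
  bit true  = 1ℤ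

  infix 4 _≈₁_

  -- A record rather than a synonym, so that `a` and `b` can be inferred: `∣ a - b ∣ ℕ.≤ 1` does not
  -- determine them.
  record _≈₁_ (a b : ℤ) : Set where
    constructor close
    field
      distance≤1 : ∣ a - b ∣ ℕ.≤ 1

  open _≈₁_

  ≈₁-cong : ∀ {a b c d} → a - b ≡ c - d → a ≈₁ b → c ≈₁ d
  ≈₁-cong eq (close p) = close (subst (λ t → ∣ t ∣ ℕ.≤ 1) eq p)

  ≈₁-refl : ∀ {a} → a ≈₁ a
  ≈₁-refl {a} = close (subst (λ t → ∣ t ∣ ℕ.≤ 1) (sym (ℤ.+-inverseʳ a)) z≤n)

  bit-≈₁ : ∀ β γ → bit β ≈₁ bit γ
  bit-≈₁ false false = close z≤n
  bit-≈₁ false true  = close (s≤s z≤n)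
  bit-≈₁ true  false = close (s≤s z≤n)
  bit-≈₁ true  true  = close z≤n

  -- The distance is twice `∣ a - b ∣`, so it is below 2 only if it vanishes.
  2*-≈₁ : ∀ a b → + 2 * a ≈₁ + 2 * b → a ≡ b
  2*-≈₁ a b (close p) = ℤ.i-j≡0⇒i≡j a b (ℤ.∣i∣≡0⇒i≡0 (ℕ.n<1⇒n≡0
    (ℕ.*-cancelˡ-< 2 ∣ a - b ∣ 1 (s≤s (subst (ℕ._≤ 1) twice p)))))
    where
    2* : ∀ a b → + 2 * a - + 2 * b ≡ + 2 * (a - b)
    2* = ℤ-Solver.solve-∀
    twice : ∣ + 2 * a - + 2 * b ∣ ≡ 2 ℕ.* ∣ a - b ∣
    twice = trans (cong ∣_∣ (2* a b)) (ℤ.abs-* (+ 2) (a - b))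

  2*-cancel : ∀ a b → + 2 * a ≡ + 2 * b → a ≡ b
  2*-cancel a b eq = 2*-≈₁ a b (subst (+ 2 * a ≈₁_) eq ≈₁-refl)

  2a≢2b+1 : ∀ a b → + 2 * a ≢ + 2 * b + 1ℤ
  2a≢2b+1 a b eq = contradiction
    (trans (sym (ℤ.abs-* (+ 2) (a - b))) (cong ∣_∣ (trans (2* a b) (trans (cong (_- + 2 * b) eq) (1+ b)))))
    (even≢1 ∣ a - b ∣)
    where
    2* : ∀ a b → + 2 * (a - b) ≡ + 2 * a - + 2 * b
    2* = ℤ-Solver.solve-∀
    1+ : ∀ b → + 2 * b + 1ℤ - + 2 * b ≡ 1ℤ
    1+ = ℤ-Solver.solve-∀
    even≢1 : ∀ n → 2 ℕ.* n ≢ 1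
    even≢1 zero    ()
    even≢1 (suc n) eq = ℕ.1+n≢0 (trans (sym (ℕ.+-suc n (n ℕ.+ 0))) (ℕ.suc-injective eq))

  2*+bit-injective : ∀ a b β γ → + 2 * a + bit β ≡ + 2 * b + bit γ → a ≡ b × β ≡ γ
  2*+bit-injective a b false false eq =
    2*-cancel a b (trans (sym (ℤ.+-identityʳ _)) (trans eq (ℤ.+-identityʳ _))) , refl
  2*+bit-injective a b true  true  eq = 2*-cancel a b (∙-cancelʳ 1ℤ _ _ eq) , refl
  2*+bit-injective a b false true  eq = contradiction (trans (sym (ℤ.+-identityʳ _)) eq) (2a≢2b+1 a b)
  2*+bit-injective a b true  false eq = contradiction (trans (sym (ℤ.+-identityʳ _)) (sym eq)) (2a≢2b+1 b a)

  -- Rounds down for negative `a` too, since the remainder `_%ℕ_` is never negative.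
  half : ℤ → ℤ
  half a = a /ℕ 2

  half-spec : ∀ a → ∃ λ β → a ≡ + 2 * half a + bit β
  half-spec a with a %ℕ 2 | n%ℕd<d a 2 | a≡a%ℕn+[a/ℕn]*n a 2
  ... | 0 | _ | eq = false , trans eq (swap (half a))
    where
    swap : ∀ h → 0ℤ + h * + 2 ≡ + 2 * h + 0ℤ
    swap = ℤ-Solver.solve-∀
  ... | 1 | _ | eq = true , trans eq (swap (half a))
    where
    swap : ∀ h → 1ℤ + h * + 2 ≡ + 2 * h + 1ℤ
    swap = ℤ-Solver.solve-∀
  ... | suc (suc _) | s≤s (s≤s ()) | _

  half-unique : ∀ {a} h β → a ≡ + 2 * h + bit β → half a ≡ h
  half-unique {a} h β eq with half-spec a
  ... | γ , spec = proj₁ (2*+bit-injective _ h γ β (trans (sym spec) eq))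

  -- The second summand is half of `a` rounded up.
  half-sum : ∀ a → half a + half (1ℤ + a) ≡ a
  half-sum a with half-spec a
  ... | false , spec = trans
      (cong (_+_ (half a)) (half-unique (half a) true (trans (cong (_+_ 1ℤ) spec) (odd (half a)))))
      (trans (even (half a)) (sym spec))
    where
    odd : ∀ h → 1ℤ + (+ 2 * h + 0ℤ) ≡ + 2 * h + 1ℤ
    odd = ℤ-Solver.solve-∀
    even : ∀ h → h + h ≡ + 2 * h + 0ℤ
    even = ℤ-Solver.solve-∀
  ... | true  , spec = trans
      (cong (_+_ (half a)) (half-unique (1ℤ + half a) false (trans (cong (_+_ 1ℤ) spec) (even (half a)))))
      (trans (odd (half a)) (sym spec))
    where
    even : ∀ h → 1ℤ + (+ 2 * h + 1ℤ) ≡ + 2 * (1ℤ + h) + 0ℤ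
    even = ℤ-Solver.solve-∀
    odd : ∀ h → h + (1ℤ + h) ≡ + 2 * h + 1ℤ
    odd = ℤ-Solver.solve-∀

  ∣i∣≡2 : ∀ i → ∣ i ∣ ≡ 2 → i ≡ + 2 * + 1 ⊎ i ≡ + 2 * -[1+ 0 ]
  ∣i∣≡2 (+ _)     refl = inj₁ refl
  ∣i∣≡2 -[1+ _ ]  refl = inj₂ refl

  -- Values of opposite parity differ by an odd number, which rules out a difference of exactly 2.
  odd-≈₁ : ∀ a b β γ → β ≢ γ → ∣ (+ 2 * a + bit β) - (+ 2 * b + bit γ) ∣ ℕ.≤ 2 →
           + 2 * a + bit β ≈₁ + 2 * b + bit γ
  odd-≈₁ a b β γ β≢γ le = close (ℕ.≤-pred (ℕ.≤∧≢⇒< le λ eq →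
    [ impossible 1ℤ , impossible -[1+ 0 ] ] (∣i∣≡2 _ eq)))
    where
    shift : ∀ x y → x ≡ (x - y) + y
    shift = ℤ-Solver.solve-∀
    regroup : ∀ c b γ → + 2 * c + (+ 2 * b + γ) ≡ + 2 * (c + b) + γ
    regroup = ℤ-Solver.solve-∀
    impossible : ∀ c → (+ 2 * a + bit β) - (+ 2 * b + bit γ) ≡ + 2 * c → ⊥
    impossible c eq = β≢γ (proj₂ (2*+bit-injective a (c + b) β γ (trans (shift _ (+ 2 * b + bit γ))
      (trans (cong (_+ (+ 2 * b + bit γ)) eq) (regroup c b (bit γ))))))

  ∣p∣+∣q∣ : ∀ p q → ∣ p ∣ ℕ.+ ∣ q ∣ ≡ ∣ p + q ∣ ⊎ ∣ p ∣ ℕ.+ ∣ q ∣ ≡ ∣ p - q ∣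
  ∣p∣+∣q∣ (+ _)     (+ _)          = inj₁ refl
  ∣p∣+∣q∣ (+ _)     -[1+ _ ]       = inj₂ refl
  ∣p∣+∣q∣ -[1+ _ ]  (+ zero)       = inj₁ (cong suc (ℕ.+-identityʳ _))
  ∣p∣+∣q∣ -[1+ m ]  (+ suc n)      = inj₂ (cong suc (ℕ.+-suc m n))
  ∣p∣+∣q∣ -[1+ m ]  -[1+ n ]       = inj₁ (cong suc (ℕ.+-suc m n))

  -- By `∣p∣+∣q∣` the total change equals the change of the sum or that of the difference, according
  -- to the signs of the two changes.
  ±-≈₁ : ∀ a b a′ b′ → a + b ≈₁ a′ + b′ → a + - b ≈₁ a′ + - b′ → ∣ a - a′ ∣ ℕ.+ ∣ b - b′ ∣ ℕ.≤ 1
  ±-≈₁ a b a′ b′ (close plus) (close minus) with ∣p∣+∣q∣ (a - a′) (b - b′)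
  ... | inj₁ eq = subst (ℕ._≤ 1) (trans (cong ∣_∣ (regroup a b a′ b′)) (sym eq)) plus
    where
    regroup : ∀ a b a′ b′ → (a + b) - (a′ + b′) ≡ (a - a′) + (b - b′)
    regroup = ℤ-Solver.solve-∀
  ... | inj₂ eq = subst (ℕ._≤ 1) (trans (cong ∣_∣ (regroup a b a′ b′)) (sym eq)) minus
    where
    regroup : ∀ a b a′ b′ → (a + - b) - (a′ + - b′) ≡ (a - a′) - (b - b′)
    regroup = ℤ-Solver.solve-∀

  ≢⇒∣-∣>0 : ∀ a b → a ≢ b → 1 ℕ.≤ ∣ a - b ∣
  ≢⇒∣-∣>0 a b a≢b = ℕ.n≢0⇒n>0 (a≢b ∘ ℤ.i-j≡0⇒i≡j a b ∘ ℤ.∣i∣≡0⇒i≡0)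

  -- Hypercube vertices cut into two blocks, and their parity.

  Cube : ℕ → Set
  Cube = Vec Bool

  -- An inductive form of the hypercube's adjacency that follows the recursion of `take` and `drop`.
  -- Equalities are arguments rather than shared indices, so that matching need not unify terms such
  -- as `take m u` and `take m v`.
  data Adjacent : ∀ {m} → Cube m → Cube m → Set where
    here  : ∀ {m b c} {u v : Cube m} → b ≢ c → u ≡ v → Adjacent (b ∷ u) (c ∷ v)
    there : ∀ {m b c} {u v : Cube m} → b ≡ c → Adjacent u v → Adjacent (b ∷ u) (c ∷ v)

  lookup-injective : ∀ {m} {u v : Cube m} → (∀ i → lookup u i ≡ lookup v i) → u ≡ v
  lookup-injective {u = []}    {[]}    _  = refl
  lookup-injective {u = _ ∷ _} {_ ∷ _} eq = cong₂ _∷_ (eq zero) (lookup-injective (eq ∘ suc))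

  take-drop-injective : ∀ m {n} {u v : Cube (m ℕ.+ n)} → take m u ≡ take m v → drop m u ≡ drop m v → u ≡ v
  take-drop-injective m {u = u} {v} t d =
    trans (sym (Vec.take++drop≡id m u)) (trans (cong₂ _++_ t d) (Vec.take++drop≡id m v))

  adjacent-split : ∀ m {n} {u v : Cube (m ℕ.+ n)} → Adjacent u v →
    Adjacent (take m u) (take m v) × drop m u ≡ drop m v ⊎
    take m u ≡ take m v × Adjacent (drop m u) (drop m v)
  adjacent-split zero    adj           = inj₂ (refl , adj)
  adjacent-split (suc m) (here b≢c eq) = inj₁ (here b≢c (cong (take m) eq) , cong (drop m) eq)
  adjacent-split (suc m) (there eq adj) with adjacent-split m adj
  ... | inj₁ (t , d) = inj₁ (there eq t , d)
  ... | inj₂ (t , d) = inj₂ (cong₂ _∷_ eq t , d)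

  adjacent-take : ∀ m {n} {u v : Cube (m ℕ.+ n)} →
    Adjacent (take m u) (take m v) → drop m u ≡ drop m v → Adjacent u v
  adjacent-take (suc m) {u = _ ∷ _} {_ ∷ _} (here b≢c t)   d = here b≢c (take-drop-injective m t d)
  adjacent-take (suc m) {u = _ ∷ _} {_ ∷ _} (there eq adj) d = there eq (adjacent-take m adj d)

  adjacent-drop : ∀ m {n} {u v : Cube (m ℕ.+ n)} →
    take m u ≡ take m v → Adjacent (drop m u) (drop m v) → Adjacent u v
  adjacent-drop zero    t adj = adj
  adjacent-drop (suc m) {u = _ ∷ _} {_ ∷ _} t adj =
    there (Vec.∷-injectiveˡ t) (adjacent-drop m (Vec.∷-injectiveʳ t) adj)

  parity : ∀ {m} → Cube m → Bool
  parity []      = false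
  parity (b ∷ u) = b xor parity u

  parity-flips : ∀ {m} {u v : Cube m} → Adjacent u v → parity u ≢ parity v
  parity-flips (here {b = false} {false} b≢c _)    _  = b≢c refl
  parity-flips (here {b = true}  {true}  b≢c _)    _  = b≢c refl
  parity-flips (here {b = false} {true}  {u} _ refl)  eq = Bool.not-¬ {parity u} refl eq
  parity-flips (here {b = true}  {false} {u} _ refl)  eq = Bool.not-¬ {parity u} refl (sym eq)
  parity-flips (there {b = false} refl adj)         eq = parity-flips adj eq
  parity-flips (there {b = true}  refl adj)         eq = parity-flips adj (Bool.not-injective eq)

  -- Lipschitz tests, and the identifying and separating families built from them.

  Lipschitz : ∀ {m} → (Cube m → ℤ) → Set
  Lipschitz f = ∀ {u v} → Adjacent u v → f u ≈₁ f v

  infixl 6 _⊞_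

  _⊞_ : ∀ {m n} → (Cube m → ℤ) → (Cube n → ℤ) → Cube (m ℕ.+ n) → ℤ
  _⊞_ {m} f g u = f (take m u) + g (drop m u)

  -- Only one of the two halves of the coordinates changes along an edge.
  ⊞-lipschitz : ∀ {m n} (f : Cube m → ℤ) (g : Cube n → ℤ) → Lipschitz f → Lipschitz g → Lipschitz (f ⊞ g)
  ⊞-lipschitz {m} f g lf lg {u} {v} adj with adjacent-split m adj
  ... | inj₁ (t , d) rewrite d = ≈₁-cong (eq (f (take m u)) (f (take m v)) (g (drop m v))) (lf t)
    where
    eq : ∀ a b c → a - b ≡ (a + c) - (b + c)
    eq = ℤ-Solver.solve-∀
  ... | inj₂ (t , d) rewrite t = ≈₁-cong (eq (g (drop m u)) (g (drop m v)) (f (take m v))) (lg d)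
    where
    eq : ∀ a b c → a - b ≡ (c + a) - (c + b)
    eq = ℤ-Solver.solve-∀

  neg-lipschitz : ∀ {m} (f : Cube m → ℤ) → Lipschitz f → Lipschitz (-_ ∘ f)
  neg-lipschitz f lf {u} {v} adj = close
    (subst (ℕ._≤ 1) (trans (ℤ.∣i-j∣≡∣j-i∣ (f u) (f v)) (cong ∣_∣ (eq (f u) (f v)))) (distance≤1 (lf adj)))
    where
    eq : ∀ a b → b - a ≡ - a - - b
    eq = ℤ-Solver.solve-∀

  constant : ∀ {m} → ℤ → Cube m → ℤ
  constant a _ = a

  constant-lipschitz : ∀ {m} a → Lipschitz {m} (constant a)
  constant-lipschitz a _ = ≈₁-refl

  -- The tests are indexed by a type, so that families combine by disjoint union; they are counted
  -- after reindexing by `Fin`.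
  record Identifying (m : ℕ) (I : Set) : Set where
    field
      test      : I → Cube m → ℤ
      lipschitz : ∀ i → Lipschitz (test i)
      injective : ∀ {u v} → (∀ i → test i u ≡ test i v) → u ≡ v

  -- With `test i u` as left end of the `i`-th interval of `u`, two cubes meet exactly when all
  -- tests are close. This is thus a cube representation with integer corners.
  record Separating (m : ℕ) (I : Set) : Set where
    field
      test      : I → Cube m → ℤ
      lipschitz : ∀ i → Lipschitz (test i)
      separates : ∀ {u v} → (∀ i → test i u ≈₁ test i v) → u ≡ v ⊎ Adjacent u v

  module _ {I J : Set} (I↔J : I ↔ J) where
    open Inverse I↔J

    identifying-reindex : ∀ {m} → Identifying m J → Identifying m I
    identifying-reindex idf = record
      { test      = test ∘ to
      ; lipschitz = lipschitz ∘ to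
      ; injective = λ {u} {v} eq → injective λ j →
          subst (λ j → test j u ≡ test j v) (strictlyInverseˡ j) (eq (from j))
      }
      where open Identifying idf

    separating-reindex : ∀ {m} → Separating m J → Separating m I
    separating-reindex sep = record
      { test      = test ∘ to
      ; lipschitz = lipschitz ∘ to
      ; separates = λ {u} {v} near → separates λ j →
          subst (λ j → test j u ≈₁ test j v) (strictlyInverseˡ j) (near (from j))
      }
      where open Separating sep

  -- The face with first bit `false` is an induced copy of the smaller hypercube.
  separating-pred : ∀ {m I} → Separating (suc m) I → Separating m I
  separating-pred sep = record
    { test      = λ i u → test i (false ∷ u)
    ; lipschitz = λ i adj → lipschitz i (there refl adj)
    ; separates = λ near → shrink (separates near)
    }
    where
    open Separating sep
    shrink : ∀ {u v} → false ∷ u ≡ false ∷ v ⊎ Adjacent (false ∷ u) (false ∷ v) → u ≡ v ⊎ Adjacent u v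
    shrink (inj₁ eq)              = inj₁ (Vec.∷-injectiveʳ eq)
    shrink (inj₂ (here b≢c _))    = contradiction refl b≢c
    shrink (inj₂ (there _ adj))   = inj₂ adj

  separating-restrict : ∀ {m n I} → m ℕ.≤′ n → Separating n I → Separating m I
  separating-restrict (ℕ.≤′-reflexive refl) = id
  separating-restrict (ℕ.≤′-step m≤n)       = separating-restrict m≤n ∘ separating-pred

  identifying-1 : Identifying 1 (Fin 1)
  identifying-1 = record
    { test      = λ { _ (b ∷ []) → bit b }
    ; lipschitz = λ { _ {b ∷ []} {c ∷ []} _ → bit-≈₁ b c }
    ; injective = λ { {b ∷ []} {c ∷ []} eq →
        cong (_∷ []) (proj₂ (2*+bit-injective 0ℤ 0ℤ b c (cong (_+_ 0ℤ) (eq zero)))) }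
    }

  -- The empty family works because any two vertices of `Cube 1` are equal or adjacent.
  separating-1 : Separating 1 (Fin 0)
  separating-1 = record
    { test      = λ ()
    ; lipschitz = λ ()
    ; separates = λ { {b ∷ []} {c ∷ []} _ → compare b c }
    }
    where
    compare : ∀ b c → b ∷ [] ≡ c ∷ [] ⊎ Adjacent (b ∷ []) (c ∷ [])
    compare b c with b Bool.≟ c
    ... | yes refl = inj₁ refl
    ... | no  b≢c  = inj₂ (here b≢c refl)

  -- Each half is tested on its own. Tests and coordinates both double, so their ratio is kept.
  identifying-double : ∀ {m I} → Identifying m I → Identifying (m ℕ.+ m) (I ⊎ I)
  identifying-double {m} idf = record
    { test      = [ (λ i → test i ⊞ constant 0ℤ) , (λ i → constant 0ℤ ⊞ test i) ]
    ; lipschitz = [ (λ i → ⊞-lipschitz (test i) (constant 0ℤ) (lipschitz i) (constant-lipschitz 0ℤ))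
                  , (λ i → ⊞-lipschitz (constant 0ℤ) (test i) (constant-lipschitz 0ℤ) (lipschitz i)) ]
    ; injective = λ eq → take-drop-injective m
        (injective λ i → ∙-cancelʳ 0ℤ _ _ (eq (inj₁ i)))
        (injective λ i → trans (sym (ℤ.+-identityˡ _)) (trans (eq (inj₂ i)) (ℤ.+-identityˡ _)))
    }
    where
    open Identifying idf

  -- Adding the two equations cancels `b` and leaves `2 * a` plus the bit, which is therefore a
  -- parity.
  sum-difference : ∀ a b a′ b′ β γ → a + b + bit β ≡ a′ + b′ + bit γ → a + - b + 0ℤ ≡ a′ + - b′ + 0ℤ →
                   a ≡ a′ × b ≡ b′ × β ≡ γ
  sum-difference a b a′ b′ β γ sum diff = a≡a′ , ℤ.neg-injective (∙-cancelˡ a _ _ -b≡) , β≡γ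
    where
    add : ∀ a b c → (a + b + c) + (a + - b + 0ℤ) ≡ + 2 * a + c
    add = ℤ-Solver.solve-∀
    first : a ≡ a′ × β ≡ γ
    first = 2*+bit-injective a a′ β γ
      (trans (sym (add a b (bit β))) (trans (cong₂ _+_ sum diff) (add a′ b′ (bit γ))))
    a≡a′ = proj₁ first
    β≡γ  = proj₂ first
    -b≡ : a + - b ≡ a + - b′
    -b≡ = trans (∙-cancelʳ 0ℤ _ _ diff) (cong (_+ - b′) (sym a≡a′))

  -- The Cantor–Mills recursion [ D D I ; D -D 0 ] for detecting matrices: the sum
  -- of corresponding rows reveals the third block modulo 2.
  cantor-mills : ∀ {m k} → Identifying m (Fin k) → Identifying ((m ℕ.+ m) ℕ.+ k) (Fin k ⊎ Fin k)
  cantor-mills {m} {k} idf = record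
    { test      = [ (λ i → test i ⊞ test i ⊞ bitAt i) , (λ i → test i ⊞ (-_ ∘ test i) ⊞ constant 0ℤ) ]
    ; lipschitz = [ (λ i → ⊞-lipschitz (test i ⊞ test i) (bitAt i)
                      (⊞-lipschitz (test i) (test i) (lipschitz i) (lipschitz i)) (bitAt-lipschitz i))
                  , (λ i → ⊞-lipschitz (test i ⊞ (-_ ∘ test i)) (constant 0ℤ)
                      (⊞-lipschitz (test i) (-_ ∘ test i) (lipschitz i) (neg-lipschitz (test i) (lipschitz i)))
                      (constant-lipschitz 0ℤ)) ]
    ; injective = λ eq →
        let known = λ i → sum-difference _ _ _ _ _ _ (eq (inj₁ i)) (eq (inj₂ i))
        in take-drop-injective (m ℕ.+ m)
             (take-drop-injective m (injective (proj₁ ∘ known)) (injective (proj₁ ∘ proj₂ ∘ known)))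
             (lookup-injective (proj₂ ∘ proj₂ ∘ known))
    }
    where
    open Identifying idf
    bitAt : Fin k → Cube k → ℤ
    bitAt i u = bit (lookup u i)
    bitAt-lipschitz : ∀ i → Lipschitz (bitAt i)
    bitAt-lipschitz i {u} {v} _ = bit-≈₁ (lookup u i) (lookup v i)

  -- The greatest integer at most `f u` with the parity of `u`. Applied to `1ℤ + f` it gives the
  -- least such integer that is at least `f u`.
  rounded : ∀ {m} → (Cube m → ℤ) → Cube m → ℤ
  rounded f u = + 2 * half (f u - bit (parity u)) + bit (parity u)

  -- Rounding lowers each value by a bit, so the change along an edge is at most 2; it is odd
  -- because the parity flips.
  rounded-lipschitz : ∀ {m} (f : Cube m → ℤ) → Lipschitz f → Lipschitz (rounded f)
  rounded-lipschitz f lf {u} {v} adj = odd-≈₁ (half x) (half y) (parity u) (parity v) (parity-flips adj)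
    (subst (λ t → ∣ t ∣ ℕ.≤ 2) (sym split)
      (ℕ.≤-trans (ℤ.∣i+j∣≤∣i∣+∣j∣ (f u - f v) (bit γ - bit β))
        (ℕ.+-mono-≤ (distance≤1 (lf adj)) (distance≤1 (bit-≈₁ γ β)))))
    where
    x = f u - bit (parity u)
    y = f v - bit (parity v)
    β = proj₁ (half-spec x)
    γ = proj₁ (half-spec y)
    regroup : ∀ h h′ s t b c → (+ 2 * h + s) - (+ 2 * h′ + t) ≡
              (((+ 2 * h + b) + s) - ((+ 2 * h′ + c) + t)) + (c - b)
    regroup = ℤ-Solver.solve-∀
    unshift : ∀ a b s t → ((a - s) + s) - ((b - t) + t) ≡ a - b
    unshift = ℤ-Solver.solve-∀
    split : rounded f u - rounded f v ≡ (f u - f v) + (bit γ - bit β)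
    split = trans (regroup (half x) (half y) (bit (parity u)) (bit (parity v)) (bit β) (bit γ))
      (cong (_+ (bit γ - bit β)) (trans
        (cong₂ (λ s t → (s + bit (parity u)) - (t + bit (parity v)))
          (sym (proj₂ (half-spec x))) (sym (proj₂ (half-spec y))))
        (unshift (f u) (f v) (bit (parity u)) (bit (parity v)))))

  rounded-sum : ∀ {m} (f : Cube m → ℤ) u → rounded f u + rounded (λ w → 1ℤ + f w) u ≡ + 2 * f u
  rounded-sum f u = trans
    (cong (λ t → rounded f u + (+ 2 * half t + s)) (shift (f u) s))
    (trans (collect (half (f u - s)) (half (1ℤ + (f u - s))) s)
      (trans (cong (λ t → + 2 * (t + s)) (half-sum (f u - s))) (cancel (f u) s)))
    where
    s = bit (parity u)
    shift : ∀ a s → (1ℤ + a) - s ≡ 1ℤ + (a - s)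
    shift = ℤ-Solver.solve-∀
    collect : ∀ h h′ s → (+ 2 * h + s) + (+ 2 * h′ + s) ≡ + 2 * ((h + h′) + s)
    collect = ℤ-Solver.solve-∀
    cancel : ∀ a s → + 2 * ((a - s) + s) ≡ + 2 * a
    cancel = ℤ-Solver.solve-∀

  -- Rounding down and up to the parity of the vertex loses nothing, as the two
  -- roundings of f add up to 2 f.
  identifying-rounded : ∀ {m I} → Identifying m I → ∃ λ (f : I ⊎ I → Cube m → ℤ) →
    (∀ i → Lipschitz (rounded (f i))) × (∀ {u v} → (∀ i → rounded (f i) u ≡ rounded (f i) v) → u ≡ v)
  identifying-rounded idf = f , (λ i → rounded-lipschitz (f i) (f-lipschitz i)) ,
    λ {u} {v} eq → injective λ i → 2*-cancel _ _
      (trans (sym (rounded-sum (test i) u))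
        (trans (cong₂ _+_ (eq (inj₁ i)) (eq (inj₂ i))) (rounded-sum (test i) v)))
    where
    open Identifying idf
    f = [ test , (λ i u → 1ℤ + test i u) ]
    shift : ∀ a b → a - b ≡ (1ℤ + a) - (1ℤ + b)
    shift = ℤ-Solver.solve-∀
    f-lipschitz : ∀ i → Lipschitz (f i)
    f-lipschitz (inj₁ i) adj = lipschitz i adj
    f-lipschitz (inj₂ i) adj = ≈₁-cong (shift (test i _) (test i _)) (lipschitz i adj)

  -- Equal parities of the vertices make the difference of the rounded values even.
  rounded-≈₁ : ∀ {m} (f : Cube m → ℤ) {u v} → parity u ≡ parity v → rounded f u ≈₁ rounded f v →
               rounded f u ≡ rounded f v
  rounded-≈₁ f {u} {v} eq near = cong₂ (λ h β → + 2 * h + bit β) (2*-≈₁ h h′ (≈₁-cong diff near)) eq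
    where
    h  = half (f u - bit (parity u))
    h′ = half (f v - bit (parity v))
    cancel : ∀ a b c → (a + c) - (b + c) ≡ a - b
    cancel = ℤ-Solver.solve-∀
    diff : rounded f u - rounded f v ≡ + 2 * h - + 2 * h′
    diff = trans (cong (λ β → rounded f u - (+ 2 * h′ + bit β)) (sym eq))
      (cancel (+ 2 * h) (+ 2 * h′) (bit (parity u)))

  rounded-≢ : ∀ {m} (f : Cube m → ℤ) {u v} → parity u ≢ parity v → rounded f u ≢ rounded f v
  rounded-≢ f {u} {v} neq eq = neq (proj₂ (2*+bit-injective
    (half (f u - bit (parity u))) (half (f v - bit (parity v))) (parity u) (parity v) eq))

  -- If g ⊞ g and g ⊞ - g both change by at most 1, then g is constant on one half
  -- and changes by at most 1 on the other.  A half of unchanged parity is thus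
  -- unchanged, and not both parities change, since an odd change is nonzero.
  separating-double : ∀ {m I J} → Separating m J → Identifying m I →
                      Separating (m ℕ.+ m) (J ⊎ ((I ⊎ I) ⊎ (I ⊎ I)))
  separating-double {m} {I} {J} sep idf with identifying-rounded idf
  ... | f , f-lipschitz , f-injective = record
    { test      = tests
    ; lipschitz = [ (λ j → ⊞-lipschitz (test j) (test j) (lipschitz j) (lipschitz j))
                  , [ (λ i → ⊞-lipschitz (g i) (g i) (f-lipschitz i) (f-lipschitz i))
                    , (λ i → ⊞-lipschitz (g i) (-_ ∘ g i) (f-lipschitz i) (neg-lipschitz (g i) (f-lipschitz i))) ] ]
    ; separates = conclude
    }
    where
    open Separating sep
    g : I ⊎ I → Cube m → ℤ
    g = rounded ∘ f
    tests : J ⊎ ((I ⊎ I) ⊎ (I ⊎ I)) → Cube (m ℕ.+ m) → ℤ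
    tests = [ (λ j → test j ⊞ test j) , [ (λ i → g i ⊞ g i) , (λ i → g i ⊞ (-_ ∘ g i)) ] ]
    cancelʳ : ∀ a b c → (a + c) - (b + c) ≡ a - b
    cancelʳ = ℤ-Solver.solve-∀
    cancelˡ : ∀ a b c → (c + a) - (c + b) ≡ a - b
    cancelˡ = ℤ-Solver.solve-∀
    unchanged : ∀ {u v : Cube m} → parity u ≡ parity v → (∀ i → g i u ≈₁ g i v) → u ≡ v
    unchanged eq near = f-injective λ i → rounded-≈₁ (f i) eq (near i)
    conclude : ∀ {u v} → (∀ i → tests i u ≈₁ tests i v) → u ≡ v ⊎ Adjacent u v
    conclude {w} {w′} near = cases (parity u Bool.≟ parity v) (parity u′ Bool.≟ parity v′)
      where
      u  = take m w
      u′ = drop m w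
      v  = take m w′
      v′ = drop m w′
      total : ∀ i → ∣ g i u - g i v ∣ ℕ.+ ∣ g i u′ - g i v′ ∣ ℕ.≤ 1
      total i = ±-≈₁ (g i u) (g i u′) (g i v) (g i v′) (near (inj₂ (inj₁ i))) (near (inj₂ (inj₂ i)))
      cases : Dec (parity u ≡ parity v) → Dec (parity u′ ≡ parity v′) → w ≡ w′ ⊎ Adjacent w w′
      -- The first halves agree, so `test j ⊞ test j` changes exactly as `test j` does on the second
      -- halves.
      cases (yes p) _ = Sum.map (take-drop-injective m t) (adjacent-drop m t)
        (separates λ j → ≈₁-cong (cancelˡ (test j u′) (test j v′) (test j v))
          (subst (λ x → test j x + test j u′ ≈₁ test j v + test j v′) t (near (inj₁ j))))
        where
        t : u ≡ v
        t = unchanged p λ i → close (ℕ.m+n≤o⇒m≤o ∣ g i u - g i v ∣ (total i))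
      cases (no _) (yes p) = Sum.map (λ t → take-drop-injective m t d) (λ t → adjacent-take m t d)
        (separates λ j → ≈₁-cong (cancelʳ (test j u) (test j v) (test j v′))
          (subst (λ x → test j u + test j x ≈₁ test j v + test j v′) d (near (inj₁ j))))
        where
        d : u′ ≡ v′
        d = unchanged p λ i → close (ℕ.m+n≤o⇒n≤o ∣ g i u - g i v ∣ (total i))
      -- Any index would make both halves change, for a total of at least 2. Hence there is no
      -- index, and the premise of `f-injective` holds vacuously, giving `u ≡ v` against `p`.
      cases (no p) (no q) = contradiction (cong parity (f-injective {u} {v} (⊥-elim ∘ impossible))) p
        where
        impossible : I ⊎ I → ⊥
        impossible i = ℕ.<⇒≱ (ℕ.+-mono-≤
          (≢⇒∣-∣>0 (g i u) (g i v) (rounded-≢ (f i) p))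
          (≢⇒∣-∣>0 (g i u′) (g i v′) (rounded-≢ (f i) q))) (total i)

open Tests

-- Counting tests against coordinates.

module Counting where

  open import Data.Nat.Base using (_+_; _*_; _^_; _≤_)
  open import Defs using (n<2^n)

  -- Written with addition so that `double m (suc t)` is definitionally the dimension `m + m` of a
  -- doubled family.
  double : ℕ → ℕ → ℕ
  double a zero    = a
  double a (suc t) = double a t + double a t

  double≡ : ∀ a t → double a t ≡ a * 2 ^ t
  double≡ a zero    = sym (ℕ.*-identityʳ a)
  double≡ a (suc t) = trans (cong₂ _+_ (double≡ a t) (double≡ a t)) (eq a (2 ^ t))
    where
    eq : ∀ a x → a * x + a * x ≡ a * (2 * x)
    eq = ℕ-Solver.solve-∀

  identifying-double^ : ∀ {m r} t → Identifying m (Fin r) → Identifying (double m t) (Fin (double r t))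
  identifying-double^ zero    = id
  identifying-double^ (suc t) = identifying-reindex Fin.+↔⊎ ∘ identifying-double ∘ identifying-double^ t

  -- The n-th Cantor–Mills design uses 2 ^ n tests for about n * 2 ^ n / 2 coordinates.
  columns : ℕ → ℕ
  columns zero    = 1
  columns (suc n) = (columns n + columns n) + double 1 n

  identifying-columns : ∀ n → Identifying (columns n) (Fin (double 1 n))
  identifying-columns zero    = identifying-1
  identifying-columns (suc n) = identifying-reindex Fin.+↔⊎ (cantor-mills (identifying-columns n))

  -- The doubling at level `t` adds `4 * double r t` tests. These form a geometric series, bounded
  -- by its next term.
  separating-double^ : ∀ {m r k} t → Separating m (Fin k) → Identifying m (Fin r) →
    ∃ λ k′ → k′ ≤ k + 4 * double r t × Separating (double m t) (Fin k′)
  separating-double^ {k = k} zero sep idf = k , ℕ.m≤m+n k _ , sep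
  separating-double^ {m} {r} {k} (suc t) sep idf = step (separating-double^ t sep idf)
    where
    open ℕ.≤-Reasoning
    x = double r t
    eq : ∀ k x → (k + 4 * x) + ((x + x) + (x + x)) ≡ k + 4 * (x + x)
    eq = ℕ-Solver.solve-∀
    step : (∃ λ k′ → k′ ≤ k + 4 * x × Separating (double m t) (Fin k′)) →
           ∃ λ k′ → k′ ≤ k + 4 * (x + x) × Separating (double m (suc t)) (Fin k′)
    step (k′ , k′≤ , sep′) = k′ + ((x + x) + (x + x)) , bound ,
      separating-reindex reindex (separating-double sep′ (identifying-double^ t idf))
      where
      bound : k′ + ((x + x) + (x + x)) ≤ k + 4 * (x + x)
      bound = begin
        k′ + ((x + x) + (x + x))           ≤⟨ ℕ.+-monoˡ-≤ _ k′≤ ⟩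
        (k + 4 * x) + ((x + x) + (x + x))  ≡⟨ eq k x ⟩
        k + 4 * (x + x)                    ∎
      reindex : Fin (k′ + ((x + x) + (x + x))) ↔ (Fin k′ ⊎ ((Fin x ⊎ Fin x) ⊎ (Fin x ⊎ Fin x)))
      reindex = (↔-id _ ⊎-↔ ((Fin.+↔⊎ ⊎-↔ Fin.+↔⊎) ↔-∘ Fin.+↔⊎)) ↔-∘ Fin.+↔⊎

  2^n≤columns : ∀ n → double 1 n ≤ columns n
  2^n≤columns zero    = ℕ.≤-refl
  2^n≤columns (suc n) = ℕ.≤-trans (ℕ.+-mono-≤ (2^n≤columns n) (2^n≤columns n)) (ℕ.m≤m+n _ _)

  n≤columns : ∀ n → n ≤ columns n
  n≤columns n = begin
      n                ≤⟨ ℕ.<⇒≤ (n<2^n n) ⟩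
      2 ^ n            ≡⟨ ℕ.*-identityˡ (2 ^ n) ⟨
      1 * 2 ^ n        ≡⟨ double≡ 1 n ⟨
      double 1 n       ≤⟨ 2^n≤columns n ⟩
      columns n        ∎
    where open ℕ.≤-Reasoning

  columns-growth : ∀ n → columns (suc n) ≤ 3 * columns n
  columns-growth n = ℕ.≤-trans (ℕ.+-monoʳ-≤ _ (2^n≤columns n)) (ℕ.≤-reflexive (eq (columns n)))
    where
    eq : ∀ c → c + c + c ≡ 3 * c
    eq = ℕ-Solver.solve-∀

  -- The growth factor 3 is rounded up to 4: the right side is the number of coordinates reached
  -- from one by `n + n` doublings.
  columns≤4^n : ∀ n → columns n ≤ 2 ^ n * 2 ^ n
  columns≤4^n zero    = ℕ.≤-refl
  columns≤4^n (suc n) = begin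
      columns (suc n)                ≤⟨ columns-growth n ⟩
      3 * columns n                  ≤⟨ ℕ.*-mono-≤ (ℕ.n≤1+n 3) (columns≤4^n n) ⟩
      4 * (2 ^ n * 2 ^ n)            ≡⟨ eq (2 ^ n) ⟩
      2 ^ suc n * 2 ^ suc n          ∎
    where
    open ℕ.≤-Reasoning
    eq : ∀ x → 4 * (x * x) ≡ 2 * x * (2 * x)
    eq = ℕ-Solver.solve-∀

  -- The logarithmic saving of the design: each test accounts for at least n / 2 coordinates.
  n2^n≤2columns : ∀ n → n * double 1 n ≤ 2 * columns n
  n2^n≤2columns zero    = z≤n
  n2^n≤2columns (suc n) = begin
      suc n * (x + x)                ≡⟨ eq n x ⟩
      2 * (n * x) + 2 * x            ≤⟨ ℕ.+-monoˡ-≤ (2 * x) (ℕ.*-monoʳ-≤ 2 (n2^n≤2columns n)) ⟩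
      2 * (2 * c) + 2 * x            ≡⟨ eq′ c x ⟩
      2 * columns (suc n)            ∎
    where
    open ℕ.≤-Reasoning
    x = double 1 n
    c = columns n
    eq : ∀ n x → suc n * (x + x) ≡ 2 * (n * x) + 2 * x
    eq = ℕ-Solver.solve-∀
    eq′ : ∀ c x → 2 * (2 * c) + 2 * x ≡ 2 * ((c + c) + x)
    eq′ = ℕ-Solver.solve-∀

  -- The factor 4 ^ n is large enough that the 4 * (4 ^ n) tests which separate the
  -- first block of columns n coordinates cost no more than those of the later
  -- doublings, and small enough that log (dimension n) is of the order of n.
  dimension : ℕ → ℕ
  dimension n = double (columns n) (n + n)

  double-n+n≡ : ∀ a n → double a (n + n) ≡ a * (2 ^ n * 2 ^ n)
  double-n+n≡ a n = trans (double≡ a (n + n)) (cong (a *_) (ℕ.^-distribˡ-+-* 2 n n))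

  -- Two runs of `n + n` doublings. The first starts from one coordinate with the trivial design and
  -- is restricted to `columns n` coordinates; the second continues from there with the Cantor-Mills
  -- design.
  separating-dimension : ∀ n → ∃ λ k → k * n ≤ 12 * dimension n × Separating (dimension n) (Fin k)
  separating-dimension n = first (separating-double^ (n + n) separating-1 identifying-1)
    where
    open ℕ.≤-Reasoning
    x = double 1 n
    c = columns n
    y = 2 ^ n * 2 ^ n
    columns≤ : c ≤ double 1 (n + n)
    columns≤ = ℕ.≤-trans (columns≤4^n n)
      (ℕ.≤-reflexive (sym (trans (double-n+n≡ 1 n) (ℕ.*-identityˡ _))))
    expand : ∀ n x y → (4 * (1 * y) + 4 * (x * y)) * n ≡ 4 * (n + n * x) * y
    expand = ℕ-Solver.solve-∀
    collect : ∀ c y → 4 * (c + 2 * c) * y ≡ 12 * (c * y)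
    collect = ℕ-Solver.solve-∀
    bound : ∀ {k₀ k} → k₀ ≤ 4 * double 1 (n + n) → k ≤ k₀ + 4 * double x (n + n) → k * n ≤ 12 * dimension n
    bound {k₀} {k} k₀≤ k≤ = begin
      k * n                               ≤⟨ ℕ.*-monoˡ-≤ n (ℕ.≤-trans k≤ (ℕ.+-monoˡ-≤ _ k₀≤)) ⟩
      (4 * double 1 (n + n) + 4 * double x (n + n)) * n
        ≡⟨ cong₂ (λ s t → (4 * s + 4 * t) * n) (double-n+n≡ 1 n) (double-n+n≡ x n) ⟩
      (4 * (1 * y) + 4 * (x * y)) * n     ≡⟨ expand n x y ⟩
      4 * (n + n * x) * y
        -- The first run contributes `4 * c * y` and the second `8 * c * y`, whence the constant 12.
        ≤⟨ ℕ.*-monoˡ-≤ y (ℕ.*-monoʳ-≤ 4 (ℕ.+-mono-≤ (n≤columns n) (n2^n≤2columns n))) ⟩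
      4 * (c + 2 * c) * y                 ≡⟨ collect c y ⟩
      12 * (c * y)                        ≡⟨ cong (12 *_) (double-n+n≡ c n) ⟨
      12 * dimension n                    ∎
    second : ∀ {k₀} → k₀ ≤ 4 * double 1 (n + n) →
             (∃ λ k → k ≤ k₀ + 4 * double x (n + n) × Separating (dimension n) (Fin k)) →
             ∃ λ k → k * n ≤ 12 * dimension n × Separating (dimension n) (Fin k)
    second k₀≤ (k , k≤ , sep) = k , bound k₀≤ k≤ , sep
    first : (∃ λ k₀ → k₀ ≤ 4 * double 1 (n + n) × Separating (double 1 (n + n)) (Fin k₀)) →
            ∃ λ k → k * n ≤ 12 * dimension n × Separating (dimension n) (Fin k)
    first (k₀ , k₀≤ , sep₀) = second k₀≤
      (separating-double^ (n + n) (separating-restrict (ℕ.≤⇒≤′ columns≤) sep₀) (identifying-columns n))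

  -- A factor 3 comes from `columns` and a factor 4 from two more doublings. Rounding `d` up to the
  -- next dimension thus costs a constant factor.
  dimension-growth : ∀ n → dimension (suc n) ≤ 12 * dimension n
  dimension-growth n = begin
      dimension (suc n)                                      ≡⟨ double-n+n≡ (columns (suc n)) (suc n) ⟩
      columns (suc n) * (2 ^ suc n * 2 ^ suc n)              ≤⟨ ℕ.*-monoˡ-≤ (2 ^ suc n * 2 ^ suc n) (columns-growth n) ⟩
      3 * columns n * (2 ^ suc n * 2 ^ suc n)                ≡⟨ eq (columns n) (2 ^ n) ⟩
      12 * (columns n * (2 ^ n * 2 ^ n))                     ≡⟨ cong (12 *_) (double-n+n≡ (columns n) n) ⟨
      12 * dimension n                                       ∎
    where
    open ℕ.≤-Reasoning
    eq : ∀ c x → 3 * c * (2 * x * (2 * x)) ≡ 12 * (c * (x * x))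
    eq = ℕ-Solver.solve-∀

  dimension≤2^4n : ∀ n → dimension n ≤ 2 ^ (4 * n)
  dimension≤2^4n n = begin
      dimension n                                            ≡⟨ double-n+n≡ (columns n) n ⟩
      columns n * (2 ^ n * 2 ^ n)                            ≤⟨ ℕ.*-monoˡ-≤ (2 ^ n * 2 ^ n) (columns≤4^n n) ⟩
      2 ^ n * 2 ^ n * (2 ^ n * 2 ^ n)                        ≡⟨ eq (2 ^ n) ⟩
      (2 ^ n) ^ 4                                            ≡⟨ ℕ.^-*-assoc 2 n 4 ⟩
      2 ^ (n * 4)                                            ≡⟨ cong (2 ^_) (ℕ.*-comm n 4) ⟩
      2 ^ (4 * n)                                            ∎
    where
    open ℕ.≤-Reasoning
    eq : ∀ x → x * x * (x * x) ≡ x * (x * (x * (x * 1)))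
    eq = ℕ-Solver.solve-∀

  n≤dimension : ∀ n → n ≤ dimension n
  n≤dimension n = begin
      n                                                      ≤⟨ n≤columns n ⟩
      columns n                                              ≡⟨ ℕ.*-identityʳ (columns n) ⟨
      columns n * 1
        ≤⟨ ℕ.*-monoʳ-≤ (columns n) (ℕ.*-mono-≤ (ℕ.m^n>0 2 n) (ℕ.m^n>0 2 n)) ⟩
      columns n * (2 ^ n * 2 ^ n)                            ≡⟨ double-n+n≡ (columns n) n ⟨
      dimension n                                            ∎
    where open ℕ.≤-Reasoning

  -- A downward search from `n`, carrying the upper bound along and stopping at the first `i` with
  -- `f i ≤ d`.
  between : ∀ (f : ℕ → ℕ) {d} n → f 0 ≤ d → d ≤ f (suc n) → ∃ λ i → d ≤ f (suc i) × f i ≤ d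
  between f     zero    f0≤d d≤f1 = 0 , d≤f1 , f0≤d
  between f {d} (suc n) f0≤d d≤fn with f (suc n) ℕ.≤? d
  ... | yes fn≤d = suc n , d≤fn , fn≤d
  ... | no  fn≰d = between f n f0≤d (ℕ.≰⇒≥ fn≰d)

  -- Here `l` stands in for the logarithm of `d`. In 576 = 4 * 12 * 12 the factors come from
  -- `dimension≤2^4n`, `separating-dimension` and `dimension-growth`.
  separating-bound : ∀ d → 1 ≤ d → ∃₂ λ k l → k * l ≤ d * 576 × d ≤ 2 ^ l × Separating d (Fin k)
  -- `dimension 0` computes to 1, so `1≤d` is the lower end of the search; `n≤dimension` supplies
  -- the upper end.
  separating-bound d 1≤d with between dimension d 1≤d (ℕ.≤-trans (ℕ.n≤1+n d) (n≤dimension (suc d)))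
  ... | i , d≤ , ≤d = restrict (separating-dimension (suc i))
    where
    open ℕ.≤-Reasoning
    eq : ∀ k n → k * (4 * n) ≡ 4 * (k * n)
    eq = ℕ-Solver.solve-∀
    eq′ : ∀ a b c d → a * (b * (c * d)) ≡ d * (a * b * c)
    eq′ = ℕ-Solver.solve-∀
    restrict : (∃ λ k → k * suc i ≤ 12 * dimension (suc i) × Separating (dimension (suc i)) (Fin k)) →
               ∃₂ λ k l → k * l ≤ d * 576 × d ≤ 2 ^ l × Separating d (Fin k)
    restrict (k , k≤ , sep) = k , 4 * suc i , bound , ℕ.≤-trans d≤ (dimension≤2^4n (suc i)) ,
      separating-restrict (ℕ.≤⇒≤′ d≤) sep
      where
      bound : k * (4 * suc i) ≤ d * 576
      bound = begin
        k * (4 * suc i)               ≡⟨ eq k (suc i) ⟩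
        4 * (k * suc i)               ≤⟨ ℕ.*-monoʳ-≤ 4 k≤ ⟩
        4 * (12 * dimension (suc i))  ≤⟨ ℕ.*-monoʳ-≤ 4 (ℕ.*-monoʳ-≤ 12 (dimension-growth i)) ⟩
        4 * (12 * (12 * dimension i)) ≤⟨ ℕ.*-monoʳ-≤ 4 (ℕ.*-monoʳ-≤ 12 (ℕ.*-monoʳ-≤ 12 ≤d)) ⟩
        4 * (12 * (12 * d))           ≡⟨ eq′ 4 12 12 d ⟩
        d * 576                       ∎

open Counting using (separating-bound)

open import Defs

-- Closeness as inequalities, the embedding of integers into the reals, and the logarithm.

≈₁⇒≤ : ∀ {a b} → a ≈₁ b → a ℤ.≤ b ℤ.+ 1ℤ
≈₁⇒≤ {a} {b} (close p) = subst₂ ℤ._≤_ (restore a b) (ℤ.+-comm 1ℤ b)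
  (ℤ.+-monoˡ-≤ b (ℤ.≤-trans (i≤∣i∣ (a ℤ.- b)) (ℤ.+≤+ p)))
  where
  restore : ∀ a b → (a ℤ.- b) ℤ.+ b ≡ a
  restore = ℤ-Solver.solve-∀
  i≤∣i∣ : ∀ i → i ℤ.≤ + ∣ i ∣
  i≤∣i∣ (+ _)    = ℤ.≤-refl
  i≤∣i∣ -[1+ _ ] = ℤ.-≤+

≈₁-sym : ∀ {a b} → a ≈₁ b → b ≈₁ a
≈₁-sym {a} {b} (close p) = close (subst (ℕ._≤ 1) (ℤ.∣i-j∣≡∣j-i∣ a b) p)

≤⇒≈₁ : ∀ {a b} → a ℤ.≤ b ℤ.+ 1ℤ → b ℤ.≤ a ℤ.+ 1ℤ → a ≈₁ b
≤⇒≈₁ {a} {b} a≤ b≤ = close (bound (a ℤ.- b)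
  (subst (a ℤ.- b ℤ.≤_) (cancel b) (ℤ.+-monoˡ-≤ (ℤ.- b) a≤))
  (subst₂ ℤ._≤_ (flip a b) (cancel a) (ℤ.+-monoˡ-≤ (ℤ.- a) b≤)))
  where
  cancel : ∀ b → (b ℤ.+ 1ℤ) ℤ.- b ≡ 1ℤ
  cancel = ℤ-Solver.solve-∀
  flip : ∀ a b → b ℤ.- a ≡ ℤ.- (a ℤ.- b)
  flip = ℤ-Solver.solve-∀
  bound : ∀ i → i ℤ.≤ 1ℤ → ℤ.- i ℤ.≤ 1ℤ → ∣ i ∣ ℕ.≤ 1
  bound (+ _)    (ℤ.+≤+ p) _         = p
  bound -[1+ _ ] _         (ℤ.+≤+ p) = p

-- Built with denominator 1 directly, without normalisation, so that comparisons reduce to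
-- numerators.
fromℤ : ℤ → ℚ
fromℤ i = mkℚ i 0 (Coprimality.sym (Coprimality.1-coprimeTo ∣ i ∣))

fromℤ-+ : ∀ i j → fromℤ (i ℤ.+ j) ≡ fromℤ i ℚ.+ fromℤ j
fromℤ-+ i j = ℚ.toℚᵘ-injective (ℚᵘ.≃-sym (ℚᵘ.≃-trans (ℚ.toℚᵘ-homo-+ (fromℤ i) (fromℤ j))
  (ℚᵘ.*≡* (eq i j))))
  where
  eq : ∀ i j → (i ℤ.* 1ℤ ℤ.+ j ℤ.* 1ℤ) ℤ.* 1ℤ ≡ (i ℤ.+ j) ℤ.* 1ℤ
  eq = ℤ-Solver.solve-∀

fromℤ-mono-≤ : ∀ {i j} → i ℤ.≤ j → fromℤ i ℚ.≤ fromℤ j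
fromℤ-mono-≤ i≤j = ℚ.*≤* (ℤ.*-monoʳ-≤-nonNeg 1ℤ i≤j)

fromℤ-cancel-≤ : ∀ {i j} → fromℤ i ℚ.≤ fromℤ j → i ℤ.≤ j
fromℤ-cancel-≤ (ℚ.*≤* le) = subst₂ ℤ._≤_ (ℤ.*-identityʳ _) (ℤ.*-identityʳ _) le

fromℚ-mono-≤ : ∀ {p q} → p ℚ.≤ q → fromℚ p ≤ fromℚ q
fromℚ-mono-≤ p≤q r<p = ℚ.<-≤-trans r<p p≤q

-- If `q < p`, then `q` would lie in its own lower cut.
fromℚ-cancel-≤ : ∀ p q → fromℚ p ≤ fromℚ q → p ℚ.≤ q
fromℚ-cancel-≤ p q le = ℚ.≮⇒≥ λ q<p → ℚ.<-irrefl refl (le q<p)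

-- A rational `a` strictly between `r - q` and `p` splits `r` into `a` and `r - a`, the latter below
-- `q`.
fromℚ-+-≤ : ∀ p q → fromℚ (p ℚ.+ q) ≤ fromℚ p + fromℚ q
fromℚ-+-≤ p q {r} r<p+q = split
  (ℚ.<-dense (subst (r ℚ.- q ℚ.<_) (cancelʳ p q) (ℚ.+-monoˡ-< (ℚ.- q) r<p+q)))
  where
  open +-*-Solver
  cancelʳ : ∀ p q → (p ℚ.+ q) ℚ.- q ≡ p
  cancelʳ = solve 2 (λ p q → (p :+ q) :- q := p) refl
  cancelˡ : ∀ a q → a ℚ.+ (q ℚ.- a) ≡ q
  cancelˡ = solve 2 (λ a q → a :+ (q :- a) := q) refl
  swap : ∀ r q a → (r ℚ.- q) ℚ.+ (q ℚ.- a) ≡ r ℚ.- a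
  swap = solve 3 (λ r q a → (r :- q) :+ (q :- a) := r :- a) refl
  restore : ∀ r a → r ≡ a ℚ.+ (r ℚ.- a)
  restore = solve 2 (λ r a → r := a :+ (r :- a)) refl
  split : (∃ λ a → r ℚ.- q ℚ.< a × a ℚ.< p) → Lower (fromℚ p + fromℚ q) r
  split (a , r-q<a , a<p) = a , r ℚ.- a , a<p ,
    subst₂ ℚ._<_ (swap r q a) (cancelˡ a q) (ℚ.+-monoˡ-< (q ℚ.- a) r-q<a) , restore r a

+-fromℚ-≤ : ∀ p q → fromℚ p + fromℚ q ≤ fromℚ (p ℚ.+ q)
+-fromℚ-≤ p q (a , b , a<p , b<q , refl) = ℚ.+-mono-< a<p b<q

+-mono-≤ : ∀ x x′ y y′ → x ≤ x′ → y ≤ y′ → x + y ≤ x′ + y′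
+-mono-≤ x x′ y y′ x≤x′ y≤y′ (a , b , a<x , b<y , eq) = a , b , x≤x′ a<x , y≤y′ b<y , eq

·-monoʳ-≤ : ∀ k x y → x ≤ y → k · x ≤ k · y
·-monoʳ-≤ zero    x y x≤y = id
·-monoʳ-≤ (suc k) x y x≤y = +-mono-≤ x y (k · x) (k · y) x≤y (·-monoʳ-≤ k x y x≤y)

fromℕ : ℕ → ℝ
fromℕ n = fromℚ (fromℤ (+ n))

·-fromℕ-≤ : ∀ k n → k · fromℕ n ≤ fromℕ (k ℕ.* n)
·-fromℕ-≤ zero    n = id
·-fromℕ-≤ (suc k) n = subst (λ t → fromℕ n + k · fromℕ n ≤ fromℚ t) (sym (fromℤ-+ (+ n) (+ (k ℕ.* n))))
  (+-fromℚ-≤ (fromℤ (+ n)) (fromℤ (+ (k ℕ.* n)))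
    ∘ +-mono-≤ (fromℕ n) (fromℕ n) (k · fromℕ n) (fromℕ (k ℕ.* n)) id (·-fromℕ-≤ k n))

fromℕ-·-≤ : ∀ k n → fromℕ (k ℕ.* n) ≤ k · fromℕ n
fromℕ-·-≤ zero    n = id
fromℕ-·-≤ (suc k) n = subst (λ t → fromℚ t ≤ fromℕ n + k · fromℕ n) (sym (fromℤ-+ (+ n) (+ (k ℕ.* n))))
  (+-mono-≤ (fromℕ n) (fromℕ n) (fromℕ (k ℕ.* n)) (k · fromℕ n) id (fromℕ-·-≤ k n)
    ∘ fromℚ-+-≤ (fromℤ (+ n)) (fromℤ (+ (k ℕ.* n))))

-- If `l ≤ q` for some `q` in the lower cut, then `<-down` would put `l` there too, against
-- `d ≤ 2 ^ l`.
log₂≤ : ∀ d .{{_ : NonZero d}} l → d ℕ.≤ 2 ℕ.^ l → log₂ d ≤ fromℕ l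
log₂≤ d l d≤2^l {q} q<log = ℚ.≰⇒> λ l≤q →
  ℕ.<⇒≱ (<-down d (mkℚᵘ (+ l) 0) (toℚᵘ q) (ℚ.toℚᵘ-mono-≤ l≤q) q<log)
    (subst (ℕ._≤ 2 ℕ.^ l) (sym (ℕ.*-identityʳ d)) d≤2^l)

·-log₂-≤ : ∀ k l d e .{{_ : NonZero d}} → k ℕ.* l ℕ.≤ d ℕ.* e → d ℕ.≤ 2 ℕ.^ l → k · log₂ d ≤ d · fromℕ e
·-log₂-≤ k l d e kl≤de d≤2^l =
  fromℕ-·-≤ d e ∘ fromℚ-mono-≤ (fromℤ-mono-≤ (ℤ.+≤+ kl≤de)) ∘ ·-fromℕ-≤ k l
  ∘ ·-monoʳ-≤ k (log₂ d) (fromℕ l) (log₂≤ d l d≤2^l)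

-- The two forms of adjacency, and cubes from separating tests.

adjacent⇒~ : ∀ {m} {u v : Cube m} → Adjacent u v → Graph._~_ (hypercube m) u v
adjacent⇒~ (here b≢c refl) = zero , b≢c , λ { {zero} _ → refl ; {suc i} neq → contradiction refl neq }
adjacent⇒~ (there refl adj) with adjacent⇒~ adj
... | i , neq , unique = suc i , neq , λ { {zero} b≢b → contradiction refl b≢b ; {suc j} neq → cong suc (unique neq) }

-- A second differing position would equal the first by uniqueness. This only refutes inequality of
-- the other bits, so decidability is used to obtain equality.
~⇒adjacent : ∀ {m} {u v : Cube m} → Graph._~_ (hypercube m) u v → Adjacent u v
~⇒adjacent {u = b ∷ u} {c ∷ v} (zero , b≢c , unique) = here b≢c (lookup-injective λ i →
  decidable-stable (lookup u i Bool.≟ lookup v i) λ neq → contradiction (unique {suc i} neq) λ ())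
~⇒adjacent {u = b ∷ u} {c ∷ v} (suc i , neq , unique) = there
  (decidable-stable (b Bool.≟ c) λ b≢c → contradiction (unique {zero} b≢c) λ ())
  (~⇒adjacent (i , neq , λ neq′ → Fin.suc-injective (unique neq′)))

fromℚ-+1 : ∀ a b → a ℤ.≤ b ℤ.+ 1ℤ → fromℚ (fromℤ a) ≤ fromℚ (fromℤ b) + 1ℝ
fromℚ-+1 a b a≤ = fromℚ-+-≤ (fromℤ b) 1ℚ
  ∘ fromℚ-mono-≤ (subst (fromℤ a ℚ.≤_) (fromℤ-+ b 1ℤ) (fromℤ-mono-≤ a≤))

separating⇒representable : ∀ {d k} → Separating d (Fin k) → CubeRepresentable (hypercube d) k
separating⇒representable {d} {k} sep = corner , λ {u} {v} u≢v → mk⇔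
    (λ u~v → meet (~⇒adjacent u~v))
    (λ m → [ (λ u≡v → contradiction u≡v u≢v) , adjacent⇒~ ] (separates (near m)))
  where
  open Separating sep
  corner : Cube d → ℝ^ k
  corner u i = fromℚ (fromℤ (test i u))
  meet : ∀ {u v} → Adjacent u v → cube (corner u) ≬ cube (corner v)
  -- The coordinatewise maximum of the two corners is a common point, as the corners differ by at
  -- most 1 in each coordinate.
  meet {u} {v} adj = (λ i → fromℚ (fromℤ (test i u ℤ.⊔ test i v))) ,
    (λ i → let a = test i u ; b = test i v in
      fromℚ-mono-≤ (fromℤ-mono-≤ (ℤ.i≤i⊔j a b)) ,
      fromℚ-+1 (a ℤ.⊔ b) a (ℤ.⊔-lub (ℤ.i≤i+j a 1ℤ) (≈₁⇒≤ (≈₁-sym (lipschitz i adj))))) ,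
    (λ i → let a = test i u ; b = test i v in
      fromℚ-mono-≤ (fromℤ-mono-≤ (ℤ.i≤j⊔i a b)) ,
      fromℚ-+1 (a ℤ.⊔ b) b (ℤ.⊔-lub (≈₁⇒≤ (lipschitz i adj)) (ℤ.i≤i+j b 1ℤ)))
  below : ∀ a b x → fromℚ (fromℤ a) ≤ x → x ≤ fromℚ (fromℤ b) + 1ℝ → a ℤ.≤ b ℤ.+ 1ℤ
  below a b x a≤x x≤b+1 = fromℤ-cancel-≤ (subst (fromℤ a ℚ.≤_) (sym (fromℤ-+ b 1ℤ))
    (fromℚ-cancel-≤ (fromℤ a) (fromℤ b ℚ.+ 1ℚ) (λ r → +-fromℚ-≤ (fromℤ b) 1ℚ (x≤b+1 (a≤x r)))))
  -- A common point lies above the left end of either interval and below the right end of the other.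
  near : ∀ {u v} → cube (corner u) ≬ cube (corner v) → ∀ i → test i u ≈₁ test i v
  near {u} {v} (p , inU , inV) i = ≤⇒≈₁
    (below (test i u) (test i v) (p i) (proj₁ (inU i)) (proj₂ (inV i)))
    (below (test i v) (test i u) (p i) (proj₁ (inV i)) (proj₂ (inU i)))

-- The cubicity is at most the constructed `k` by minimality, so `k * l ≤ d * e` carries over to it.
representable-bound : ∀ d e .{{_ : NonZero d}} →
  (∃₂ λ k l → k ℕ.* l ℕ.≤ d ℕ.* e × d ℕ.≤ 2 ℕ.^ l × Separating d (Fin k)) →
  (∃ λ k → CubeRepresentable (hypercube d) k × k · log₂ d ≤ d · fromℕ e) ×
  (∀ k → IsCubicity (hypercube d) k → k · log₂ d ≤ d · fromℕ e)
representable-bound d e (k , l , kl≤ , d≤ , sep) =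
  (k , representable , ·-log₂-≤ k l d e kl≤ d≤) ,
  λ k′ (_ , minimal) → ·-log₂-≤ k′ l d e (ℕ.≤-trans (ℕ.*-monoˡ-≤ l (minimal k representable)) kl≤) d≤
  where
  representable : CubeRepresentable (hypercube d) k
  representable = separating⇒representable sep

theorem1 : ∃ λ (c : ℝ) → ∀ (d : ℕ) .{{_ : NonZero d}} → 2 ℕ.≤ d →
    (∃ λ k → CubeRepresentable (hypercube d) k × k · log₂ d ≤ d · c) ×
    (∀ k → IsCubicity (hypercube d) k → k · log₂ d ≤ d · c)
theorem1 = fromℕ 576 , λ d 2≤d → representable-bound d 576 (separating-bound d (ℕ.<⇒≤ 2≤d))
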